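{- For every feasible set of jobs, the online policy Thrashing completes every job $j$ with interval stretch $s_j=(C_j-r_j)/(d_j-r_j)\le 4$.
   Context: Jobs $j$ have release time $r_j$, due date $d_j>r_j$, work $w_j>0$, and linear speed function $f_j(t)=m_j(t-r_j)$ with $m_j>0$. A single processor runs at most one job at a time, preemption is allowed, and running job $j$ during a set of times $S$ completes $\int_S f_j(t)\,dt$ units of its work; $C_j$ denotes the completion time of job $j$. A set of jobs is feasible if some schedule runs each job only within $[r_j,d_j]$ and completes it by $d_j$. Online: job $j$ becomes known only at time $r_j$. The policy Thrashing: at each time $t$, consider the released unfinished jobs $j$ whose current stretch $(t-r_j)/(d_j-r_j)$ is at least $2$; if there is none, the processor idles, otherwise it runs the one among them with the latest release time (ties broken arbitrarily). -}

module Defs where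

open import Algebra.Bundles using (CommutativeRing)
open import Algebra.Structures using (IsCommutativeRing)
import Algebra.Properties.CommutativeMonoid.Sum as Summation
open import Data.Fin.Base using (Fin; toℕ)
open import Data.Maybe.Base using (Maybe; just; nothing)
open import Data.Nat.Base using (ℕ)
open import Data.Product.Base using (Σ-syntax; ∃-syntax; _×_)
open import Level using (0ℓ; Setω) renaming (suc to lsuc)
open import Relation.Binary.PropositionalEquality.Core using (_≡_; _≢_)
open import Relation.Binary.Structures using (IsStrictTotalOrder)
import Relation.Binary.Construct.StrictToNonStrict as NonStrict
open import Relation.Nullary.Negation.Core using (¬_)
open import Relation.Unary using (Pred; _∈_; _⊆_; _∩_; _∖_; _⊥_; Satisfiable)

-- The axioms of a Dedekind-complete ordered field, which characterise the
-- real numbers up to isomorphism.  The reals are classical: the order is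
-- trichotomous, and (by `⨆-isSup` applied to {0} ∪ {1 | P}) excluded middle
-- follows.  The functions `_⁻¹` and `⨆` are total, with values specified only
-- where they are mathematically meaningful.
record CompleteOrderedField : Setω where
  infixl 6 _+_ _-_
  infixl 7 _*_ _/_
  infix  8 -_ _⁻¹
  infix  4 _<_ _≤_
  field
    ℝ       : Set
    _+_ _*_ : ℝ → ℝ → ℝ
    -_      : ℝ → ℝ
    0# 1#   : ℝ
    _⁻¹     : ℝ → ℝ
    _<_     : ℝ → ℝ → Set

    isCommutativeRing  : IsCommutativeRing _≡_ _+_ _*_ -_ 0# 1#
    0≢1                : 0# ≢ 1#
    ⁻¹-inverseʳ        : ∀ x → x ≢ 0# → x * x ⁻¹ ≡ 1#
    isStrictTotalOrder : IsStrictTotalOrder _≡_ _<_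
    +-monoʳ-<          : ∀ x {y z} → y < z → x + y < x + z
    *-pos              : ∀ {x y} → 0# < x → 0# < y → 0# < x * y

  _≤_ : ℝ → ℝ → Set
  _≤_ = NonStrict._≤_ _≡_ _<_

  UpperBound : ∀ {ℓ} → Pred ℝ ℓ → Pred ℝ ℓ
  UpperBound P u = ∀ {x} → x ∈ P → x ≤ u

  IsSup : ∀ {ℓ} → Pred ℝ ℓ → Pred ℝ ℓ
  IsSup P s = UpperBound P s × (∀ y → y < s → ∃[ x ] (x ∈ P × y < x))

  field
    ⨆       : ∀ {ℓ} → Pred ℝ ℓ → ℝ
    ⨆-isSup : ∀ {ℓ} (P : Pred ℝ ℓ) →
              Satisfiable P → Satisfiable (UpperBound P) → IsSup P (⨆ P)

  commutativeRing : CommutativeRing 0ℓ 0ℓ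
  commutativeRing = record { isCommutativeRing = isCommutativeRing }

  open Summation (CommutativeRing.+-commutativeMonoid commutativeRing) public
    using (sum)

  _-_ : ℝ → ℝ → ℝ
  x - y = x + - y

  _/_ : ℝ → ℝ → ℝ
  x / y = x * y ⁻¹

  2# 4# : ℝ
  2# = 1# + 1#
  4# = 2# + 2#

  ⨅ : ∀ {ℓ} → Pred ℝ ℓ → ℝ
  ⨅ P = - ⨆ (λ x → - x ∈ P)

module Lebesgue (𝓡 : CompleteOrderedField) where
  open CompleteOrderedField 𝓡

  -- v is the total length of some countable cover of A by open intervals
  -- (a k , b k); a series of nonnegative terms has the supremum of its partial
  -- sums as its value.
  CoverLength : Pred ℝ 0ℓ → Pred ℝ 0ℓ
  CoverLength A v =
    Σ[ a ∈ (ℕ → ℝ) ] Σ[ b ∈ (ℕ → ℝ) ]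
      (∀ k → a k ≤ b k)
    × (∀ {x} → x ∈ A → ∃[ k ] (a k < x × x < b k))
    × IsSup (λ s → ∃[ n ] s ≡ sum {n} (λ i → b (toℕ i) - a (toℕ i))) v

  FiniteOuterMeasure : Pred ℝ 0ℓ → Set
  FiniteOuterMeasure A = Satisfiable (CoverLength A)

  -- Meaningful for A with FiniteOuterMeasure A.
  outerMeasure : Pred ℝ 0ℓ → ℝ
  outerMeasure A = ⨅ (CoverLength A)

  -- Carathéodory's criterion; it holds automatically for test sets A of
  -- infinite outer measure.
  Measurable : Pred ℝ 0ℓ → Set₁
  Measurable S =
    ∀ (A : Pred ℝ 0ℓ) → FiniteOuterMeasure A →
    outerMeasure A ≡ outerMeasure (A ∩ S) + outerMeasure (A ∖ S)

  -- v is the integral of a nonnegative simple function Σᵢ cᵢ 1_{Eᵢ} that is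
  -- supported in S and lies below f.
  SimpleIntegralBelow : Pred ℝ 0ℓ → (ℝ → ℝ) → Pred ℝ (lsuc 0ℓ)
  SimpleIntegralBelow S f v =
    Σ[ k ∈ ℕ ] Σ[ E ∈ (Fin k → Pred ℝ 0ℓ) ] Σ[ c ∈ (Fin k → ℝ) ]
      (∀ i → Measurable (E i))
    × (∀ i → E i ⊆ S)
    × (∀ i j → i ≢ j → E i ⊥ E j)
    × (∀ i → 0# ≤ c i)
    × (∀ i {x} → x ∈ E i → c i ≤ f x)
    × v ≡ sum (λ i → c i * outerMeasure (E i))

  -- The Lebesgue integral of f over S, for S measurable and bounded and f
  -- nonnegative, measurable and bounded on S.
  ∫ : Pred ℝ 0ℓ → (ℝ → ℝ) → ℝ
  ∫ S f = ⨆ (SimpleIntegralBelow S f)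

module Scheduling (𝓡 : CompleteOrderedField) where
  open CompleteOrderedField 𝓡 public
  open Lebesgue 𝓡 public

  record Job : Set where
    field
      r d w m : ℝ
      r<d : r < d
      0<w : 0# < w
      0<m : 0# < m

    speed : ℝ → ℝ
    speed t = m * (t - r)

    stretch : ℝ → ℝ
    stretch t = (t - r) / (d - r)

  open Job public

  Jobs : ℕ → Set
  Jobs n = Fin n → Job

  module _ {n : ℕ} (J : Jobs n) where

    -- The job being run at each time; `nothing` means that the processor idles.
    Assignment : Set
    Assignment = ℝ → Maybe (Fin n)

    runTimes : Assignment → Fin n → Pred ℝ 0ℓ
    runTimes σ j t = σ t ≡ just j

    -- The bounds `r` here and `t` in `workBy` make the integral below one of a
    -- nonnegative bounded function over a bounded set.
    record IsSchedule (σ : Assignment) : Set₁ where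
      field
        measurable   : ∀ j → Measurable (runTimes σ j)
        afterRelease : ∀ j {t} → t ∈ runTimes σ j → r (J j) ≤ t

    workBy : Assignment → Fin n → ℝ → ℝ
    workBy σ j t = ∫ (runTimes σ j ∩ (_< t)) (speed (J j))

    CompletedBy : Assignment → Fin n → ℝ → Set
    CompletedBy σ j t = w (J j) ≤ workBy σ j t

    IsCompletionTime : Assignment → Fin n → ℝ → Set
    IsCompletionTime σ j C =
      CompletedBy σ j C × (∀ t → t < C → ¬ CompletedBy σ j t)

    Feasible : Set₁
    Feasible =
      Σ[ σ ∈ Assignment ]
        IsSchedule σ
      × (∀ j {t} → t ∈ runTimes σ j → r (J j) ≤ t × t ≤ d (J j))
      × (∀ j → CompletedBy σ j (d (J j)))

    -- Released, unfinished under σ, and of current stretch at least 2 at time t.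
    Eligible : Assignment → ℝ → Pred (Fin n) 0ℓ
    Eligible σ t j =
      r (J j) ≤ t × ¬ CompletedBy σ j t × 2# ≤ stretch (J j) t

    ThrashingChoice : Assignment → ℝ → Maybe (Fin n) → Set
    ThrashingChoice σ t nothing  = ∀ i → ¬ Eligible σ t i
    ThrashingChoice σ t (just j) =
      Eligible σ t j × (∀ i → Eligible σ t i → r (J i) ≤ r (J j))

    -- Whether a job is eligible at t depends on σ only before t, so this
    -- describes the runs of an online policy, one for each way to break ties.
    record IsThrashing (σ : Assignment) : Set₁ where
      field
        isSchedule : IsSchedule σ
        choice     : ∀ t → ThrashingChoice σ t (σ t)

{-# OPTIONS --safe #-}

-- Suppose that job j is unfinished at time T = r + 4D, where r is its release
-- time and D = d - r.  Throughout the window [r + 2D , T), of length 2D, j is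
-- eligible, so Thrashing always runs some job i released no earlier than r, at
-- a time t ≥ r_i + 2(d_i - r_i); hence [r_i , d_i] ⊆ [r , T].  Thrashing runs i
-- at least at speed 2 m_i (d_i - r_i), twice the highest speed a feasible
-- schedule τ can use, so it spends on i at most half the time that τ does, and
-- strictly less than half for i = j.  Summing over i, it works for strictly less
-- than half the length 4D of [r , T] during the window: a contradiction.  The
-- completion time exists because the work done is a continuous function of time.
module Submission where

open import Algebra.Bundles using (CommutativeRing)
import Algebra.Construct.NaturalChoice.Max as Max
import Algebra.Construct.NaturalChoice.Min as Min
import Algebra.Properties.AbelianGroup as AbelianGroupProperties
import Algebra.Properties.CommutativeMonoid.Sum as CommutativeMonoidSum
import Algebra.Properties.CommutativeSemigroup as CommutativeSemigroupProperties
import Algebra.Properties.Ring as RingProperties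
import Algebra.Properties.Semiring.Mult.TCOptimised as Multiples
import Algebra.Properties.Semiring.Sum as SemiringSum
import Algebra.Solver.Ring as RingSolver
open import Algebra.Solver.Ring.AlmostCommutativeRing using (fromCommutativeRing; _-Raw-AlmostCommutative⟶_)
open import Data.Empty using (⊥-elim)
open import Data.Fin.Base using (Fin; zero; suc; toℕ)
import Data.Fin.Properties as Fin
open import Data.Integer.Base as ℤ using (ℤ; -[1+_])
import Data.Integer.Properties as ℤ
open import Data.Maybe.Base using (just; nothing; map)
open import Data.Maybe.Properties using (just-injective)
open import Data.Nat.Base as ℕ using (ℕ; zero; suc; z≤n; s≤s)
import Data.Nat.Properties as ℕ
open import Data.Product.Base using (∃-syntax; _×_; _,_; proj₁; proj₂)
open import Data.Sum.Base using (_⊎_; inj₁; inj₂; [_,_]′)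
open import Function.Base using (_∘_)
open import Level using (0ℓ)
open import Relation.Binary.Bundles using (StrictTotalOrder; TotalOrder)
import Relation.Binary.Construct.StrictToNonStrict as NonStrict
open import Relation.Binary.Definitions using (tri<; tri≈; tri>)
open import Relation.Binary.PropositionalEquality as ≡ using (_≡_; _≢_; refl; sym; trans; cong; cong₂; subst; subst₂; module ≡-Reasoning)
import Relation.Binary.Reasoning.StrictPartialOrder as StrictReasoning
open import Relation.Nullary.Decidable.Core using (dec⇒maybe)
open import Relation.Nullary.Negation.Core using (¬_)
open import Relation.Unary using (Pred; _∈_; _∉_; _⊆_; _∩_; _∖_; _∪_; _⊥_; Satisfiable; ∅)
open import Defs

-- Ring solver with integer coefficients over a commutative ring

module IntegerCoefficients {a ℓ} (R : CommutativeRing a ℓ) where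
  open CommutativeRing R
    hiding (zero)
    renaming (refl to ≈-refl; sym to ≈-sym; trans to ≈-trans)
  open AbelianGroupProperties +-abelianGroup using (⁻¹-∙-comm; ε⁻¹≈ε; ⁻¹-involutive)
  open CommutativeSemigroupProperties +-commutativeSemigroup using (interchange)
  open RingProperties ring using (-‿distribˡ-*; -‿distribʳ-*)
  open Multiples semiring renaming (_×_ to _·_)
  open import Relation.Binary.Reasoning.Setoid setoid

  -- With the optimised multiples, `1 · 1#` and `2 · 1#` reduce to `1#` and `1# + 1#`, so the solver
  -- constants `:1` and `:2` agree definitionally with `1#` and `2#`.
  fromℤ : ℤ → Carrier
  fromℤ (ℤ.+ n)  = n · 1#
  fromℤ -[1+ n ] = - (suc n · 1#)

  1+-homo : ∀ n → suc n · 1# ≈ 1# + n · 1#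
  1+-homo = ×-homo-+ 1# 1

  ⊖-homo : ∀ m n → fromℤ (m ℤ.⊖ n) ≈ m · 1# - n · 1#
  ⊖-homo m zero = ≈-sym (≈-trans (+-congˡ ε⁻¹≈ε) (+-identityʳ _))
  ⊖-homo zero (suc n) = ≈-sym (+-identityˡ _)
  ⊖-homo (suc m) (suc n) = begin
    fromℤ (suc m ℤ.⊖ suc n)              ≡⟨ ≡.cong fromℤ (ℤ.[1+m]⊖[1+n]≡m⊖n m n) ⟩
    fromℤ (m ℤ.⊖ n)                      ≈⟨ ⊖-homo m n ⟩
    m · 1# - n · 1#                      ≈⟨ +-identityˡ _ ⟨
    0# + (m · 1# - n · 1#)               ≈⟨ +-congʳ (-‿inverseʳ 1#) ⟨
    (1# - 1#) + (m · 1# - n · 1#)        ≈⟨ interchange _ _ _ _ ⟩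
    (1# + m · 1#) + (- 1# - n · 1#)      ≈⟨ +-cong (1+-homo m) (≈-trans (-‿cong (1+-homo n)) (≈-sym (⁻¹-∙-comm _ _))) ⟨
    suc m · 1# - suc n · 1#              ∎

  +-homo : ∀ i j → fromℤ (i ℤ.+ j) ≈ fromℤ i + fromℤ j
  +-homo (ℤ.+ m)  (ℤ.+ n)  = ×-homo-+ 1# m n
  +-homo (ℤ.+ m)  -[1+ n ] = ⊖-homo m (suc n)
  +-homo -[1+ m ] (ℤ.+ n)  = ≈-trans (⊖-homo n (suc m)) (+-comm _ _)
  +-homo -[1+ m ] -[1+ n ] = begin
    - (suc (suc (m ℕ.+ n)) · 1#)         ≡⟨ ≡.cong (λ k → - (k · 1#)) (≡.sym (ℕ.+-suc (suc m) n)) ⟩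
    - ((suc m ℕ.+ suc n) · 1#)           ≈⟨ -‿cong (×-homo-+ 1# (suc m) (suc n)) ⟩
    - (suc m · 1# + suc n · 1#)          ≈⟨ ⁻¹-∙-comm _ _ ⟨
    - (suc m · 1#) - suc n · 1#          ∎

  -‿homo : ∀ i → fromℤ (ℤ.- i) ≈ - fromℤ i
  -‿homo (ℤ.+ zero)  = ≈-sym ε⁻¹≈ε
  -‿homo (ℤ.+ suc n) = ≈-refl
  -‿homo -[1+ n ]    = ≈-sym (⁻¹-involutive _)

  *-homo-pos : ∀ m n → fromℤ (ℤ.+ m ℤ.* ℤ.+ n) ≈ fromℤ (ℤ.+ m) * fromℤ (ℤ.+ n)
  *-homo-pos m n = ≈-trans (reflexive (≡.cong fromℤ (≡.sym (ℤ.pos-* m n)))) (×1-homo-* m n)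

  *-homo-posˡ : ∀ m j → fromℤ (ℤ.+ m ℤ.* j) ≈ fromℤ (ℤ.+ m) * fromℤ j
  *-homo-posˡ m (ℤ.+ n)  = *-homo-pos m n
  *-homo-posˡ m -[1+ n ] = begin
    fromℤ (ℤ.+ m ℤ.* -[1+ n ])           ≡⟨ ≡.cong fromℤ (ℤ.neg-distribʳ-* (ℤ.+ m) (ℤ.+ suc n)) ⟨
    fromℤ (ℤ.- (ℤ.+ m ℤ.* ℤ.+ suc n))    ≈⟨ -‿homo (ℤ.+ m ℤ.* ℤ.+ suc n) ⟩
    - fromℤ (ℤ.+ m ℤ.* ℤ.+ suc n)        ≈⟨ -‿cong (*-homo-pos m (suc n)) ⟩
    - (fromℤ (ℤ.+ m) * fromℤ (ℤ.+ suc n))    ≈⟨ -‿distribʳ-* _ _ ⟩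
    fromℤ (ℤ.+ m) * fromℤ -[1+ n ]         ∎

  *-homo : ∀ i j → fromℤ (i ℤ.* j) ≈ fromℤ i * fromℤ j
  *-homo (ℤ.+ m)  j = *-homo-posˡ m j
  *-homo -[1+ m ] j = begin
    fromℤ (-[1+ m ] ℤ.* j)               ≡⟨ ≡.cong fromℤ (ℤ.neg-distribˡ-* (ℤ.+ suc m) j) ⟨
    fromℤ (ℤ.- (ℤ.+ suc m ℤ.* j))        ≈⟨ -‿homo (ℤ.+ suc m ℤ.* j) ⟩
    - fromℤ (ℤ.+ suc m ℤ.* j)            ≈⟨ -‿cong (*-homo-posˡ (suc m) j) ⟩
    - (fromℤ (ℤ.+ suc m) * fromℤ j)      ≈⟨ -‿distribˡ-* _ _ ⟩
    fromℤ -[1+ m ] * fromℤ j             ∎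

  -- Coefficients live in `ℤ`, where equality is decidable, so that cancelling terms over the
  -- abstract reals normalise and identities close by `refl`.
  homomorphism : ℤ.+-*-rawRing -Raw-AlmostCommutative⟶ fromCommutativeRing R
  homomorphism = record
    { ⟦_⟧    = fromℤ
    ; +-homo = +-homo
    ; *-homo = *-homo
    ; -‿homo = -‿homo
    ; 0-homo = ≈-refl
    ; 1-homo = ≈-refl
    }

  open RingSolver ℤ.+-*-rawRing (fromCommutativeRing R) homomorphism
    (λ i j → map (λ i≡j → reflexive (≡.cong fromℤ i≡j)) (dec⇒maybe (i ℤ.≟ j))) public
    using (Polynomial; solve; _:=_; _:+_; _:*_; _:-_; :-_; con)

  :0 :1 :2 : ∀ {n} → Polynomial n
  :0 = con (ℤ.+ 0)
  :1 = con (ℤ.+ 1)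
  :2 = con (ℤ.+ 2)

-- Order, arithmetic, suprema and infima in the real field

module OrderedField (𝓡 : CompleteOrderedField) where
  open CompleteOrderedField 𝓡
  open CommutativeRing commutativeRing public
    using (+-identityˡ; +-identityʳ; +-comm; *-comm; *-identityʳ; zeroˡ; zeroʳ; semiring)
  open IntegerCoefficients commutativeRing public
    using (solve; _:=_; _:+_; _:*_; _:-_; :-_; :0; :1; :2)

  strictTotalOrder : StrictTotalOrder _ _ _
  strictTotalOrder = record { isStrictTotalOrder = isStrictTotalOrder }

  open StrictTotalOrder strictTotalOrder public
    using (compare; strictPartialOrder)
    renaming (irrefl to <-irrefl; trans to <-trans; asym to <-asym)

  totalOrder : TotalOrder _ _ _
  totalOrder = record { isTotalOrder = NonStrict.isTotalOrder _≡_ _<_ isStrictTotalOrder }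

  open TotalOrder totalOrder public
    using () renaming (refl to ≤-refl; trans to ≤-trans; antisym to ≤-antisym; total to ≤-total)

  open Min totalOrder public
    using (_⊓_; ⊓-assoc; x⊓y≤x; x⊓y≤y; x≤y⇒x⊓y≈x; x≤y⇒y⊓x≈x; ⊓-sel; ⊓-monoˡ-≤)
  open Max totalOrder public
    using (_⊔_; x≤x⊔y; x≤y⊔x; x≤y⇒x⊔y≈y; x≤y⇒y⊔x≈y; ⊔-sel; ⊔-monoˡ-≤)

  module ≤-Reasoning = StrictReasoning strictPartialOrder

  <-≤-trans : ∀ {x y z} → x < y → y ≤ z → x < z
  <-≤-trans x<y (inj₁ y<z)  = <-trans x<y y<z
  <-≤-trans x<y (inj₂ refl) = x<y

  ≤-<-trans : ∀ {x y z} → x ≤ y → y < z → x < z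
  ≤-<-trans (inj₁ x<y)  y<z = <-trans x<y y<z
  ≤-<-trans (inj₂ refl) y<z = y<z

  <⇒≱ : ∀ {x y} → x < y → ¬ y ≤ x
  <⇒≱ x<y y≤x = <-irrefl refl (<-≤-trans x<y y≤x)

  <-or-≥ : ∀ x y → x < y ⊎ y ≤ x
  <-or-≥ x y with compare x y
  ... | tri< x<y _ _ = inj₁ x<y
  ... | tri≈ _ x≡y _ = inj₂ (inj₂ (sym x≡y))
  ... | tri> _ _ y<x = inj₂ (inj₁ y<x)

  ≮⇒≥ : ∀ {x y} → ¬ x < y → y ≤ x
  ≮⇒≥ {x} {y} x≮y with <-or-≥ x y
  ... | inj₁ x<y = ⊥-elim (x≮y x<y)
  ... | inj₂ y≤x = y≤x

  ≰⇒> : ∀ {x y} → ¬ x ≤ y → y < x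
  ≰⇒> {x} {y} x≰y with <-or-≥ y x
  ... | inj₁ y<x = y<x
  ... | inj₂ x≤y = ⊥-elim (x≰y x≤y)

  <-⊓-glb : ∀ {x y z} → x < y → x < z → x < y ⊓ z
  <-⊓-glb {x} {y} {z} x<y x<z with ⊓-sel y z
  ... | inj₁ ≡y = subst (x <_) (sym ≡y) x<y
  ... | inj₂ ≡z = subst (x <_) (sym ≡z) x<z

  <-⊔-lub : ∀ {x y z} → x < z → y < z → x ⊔ y < z
  <-⊔-lub {x} {y} {z} x<z y<z with ⊔-sel x y
  ... | inj₁ ≡x = subst (_< z) (sym ≡x) x<z
  ... | inj₂ ≡y = subst (_< z) (sym ≡y) y<z

  +-monoʳ-≤ : ∀ x {y z} → y ≤ z → x + y ≤ x + z
  +-monoʳ-≤ x (inj₁ y<z)  = inj₁ (+-monoʳ-< x y<z)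
  +-monoʳ-≤ x (inj₂ refl) = ≤-refl

  +-monoˡ-≤ : ∀ x {y z} → y ≤ z → y + x ≤ z + x
  +-monoˡ-≤ x y≤z = subst₂ _≤_ (+-comm x _) (+-comm x _) (+-monoʳ-≤ x y≤z)

  +-mono-≤ : ∀ {x y u v} → x ≤ y → u ≤ v → x + u ≤ y + v
  +-mono-≤ x≤y u≤v = ≤-trans (+-monoˡ-≤ _ x≤y) (+-monoʳ-≤ _ u≤v)

  +-mono-<-≤ : ∀ {x y u v} → x < y → u ≤ v → x + u < y + v
  +-mono-<-≤ {x} {y} {u} x<y u≤v =
    <-≤-trans (subst₂ _<_ (+-comm u x) (+-comm u y) (+-monoʳ-< u x<y)) (+-monoʳ-≤ y u≤v)

  +-mono-≤-< : ∀ {x y u v} → x ≤ y → u < v → x + u < y + v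
  +-mono-≤-< x≤y u<v = ≤-<-trans (+-monoˡ-≤ _ x≤y) (+-monoʳ-< _ u<v)

  -- Certificates for linear inequalities: y - x is exhibited as a sum of
  -- differences known to be nonnegative.
  ≤-from₁ : ∀ {a b x y} → a ≤ b → y - x ≡ b - a → x ≤ y
  ≤-from₁ {a} {b} {x} {y} a≤b eq =
    subst₂ _≤_
      (solve 2 (λ a x → a :+ (x :- a) := x) refl a x)
      (trans (solve 3 (λ a b x → b :+ (x :- a) := x :+ (b :- a)) refl a b x)
        (trans (cong (x +_) (sym eq)) (solve 2 (λ x y → x :+ (y :- x) := y) refl x y)))
      (+-monoˡ-≤ (x - a) a≤b)

  <-from₁ : ∀ {a b x y} → a < b → y - x ≡ b - a → x < y
  <-from₁ {a} {b} {x} {y} a<b eq with <-or-≥ x y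
  ... | inj₁ x<y = x<y
  ... | inj₂ y≤x = ⊥-elim (<⇒≱ a<b (≤-from₁ y≤x
        (trans (solve 2 (λ a b → a :- b := :- (b :- a)) refl a b)
          (trans (cong -_ (sym eq)) (solve 2 (λ x y → :- (y :- x) := x :- y) refl x y)))))

  sum-of-differences : ∀ a b c d → (b + d) - (a + c) ≡ (b - a) + (d - c)
  sum-of-differences = solve 4 (λ a b c d → (b :+ d) :- (a :+ c) := (b :- a) :+ (d :- c)) refl

  ≤-from₂ : ∀ {a b c d x y} → a ≤ b → c ≤ d → y - x ≡ (b - a) + (d - c) → x ≤ y
  ≤-from₂ a≤b c≤d eq = ≤-from₁ (+-mono-≤ a≤b c≤d) (trans eq (sym (sum-of-differences _ _ _ _)))

  x<y⇒0<y-x : ∀ {x y} → x < y → 0# < y - x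
  x<y⇒0<y-x {x} {y} x<y = <-from₁ x<y (solve 2 (λ x y → y :- x :- :0 := y :- x) refl x y)

  x≤y⇒0≤y-x : ∀ {x y} → x ≤ y → 0# ≤ y - x
  x≤y⇒0≤y-x {x} {y} x≤y = ≤-from₁ x≤y (solve 2 (λ x y → y :- x :- :0 := y :- x) refl x y)

  x<x+y : ∀ x {y} → 0# < y → x < x + y
  x<x+y x {y} 0<y = <-from₁ 0<y (solve 2 (λ x y → (x :+ y) :- x := y :- :0) refl x y)

  x+y≤z⇒y≤z-x : ∀ {x y z} → x + y ≤ z → y ≤ z - x
  x+y≤z⇒y≤z-x {x} {y} {z} le = ≤-from₁ le (solve 3 (λ x y z → (z :- x) :- y := z :- (x :+ y)) refl x y z)

  z≤x+y⇒z-x≤y : ∀ {x y z} → z ≤ x + y → z - x ≤ y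
  z≤x+y⇒z-x≤y {x} {y} {z} le = ≤-from₁ le (solve 3 (λ x y z → y :- (z :- x) := (x :+ y) :- z) refl x y z)

  neg-mono-≤ : ∀ {x y} → x ≤ y → - y ≤ - x
  neg-mono-≤ {x} {y} x≤y = ≤-from₁ x≤y (solve 2 (λ x y → (:- x) :- (:- y) := y :- x) refl x y)

  neg-mono-< : ∀ {x y} → x < y → - y < - x
  neg-mono-< {x} {y} x<y = <-from₁ x<y (solve 2 (λ x y → (:- x) :- (:- y) := y :- x) refl x y)

  -‿involutive : ∀ x → - - x ≡ x
  -‿involutive = solve 1 (λ x → :- :- x := x) refl

  *-monoˡ-< : ∀ {c x y} → 0# < c → x < y → c * x < c * y
  *-monoˡ-< {c} {x} {y} 0<c x<y = <-from₁ (*-pos 0<c (x<y⇒0<y-x x<y))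
    (solve 3 (λ c x y → c :* y :- c :* x := c :* (y :- x) :- :0) refl c x y)

  *-monoˡ-≤ : ∀ {c x y} → 0# ≤ c → x ≤ y → c * x ≤ c * y
  *-monoˡ-≤ {c} (inj₁ 0<c)  (inj₁ x<y)  = inj₁ (*-monoˡ-< 0<c x<y)
  *-monoˡ-≤ {c} (inj₁ 0<c)  (inj₂ refl) = ≤-refl
  *-monoˡ-≤ {c} (inj₂ refl) x≤y = inj₂ (trans (zeroˡ _) (sym (zeroˡ _)))

  *-monoʳ-≤ : ∀ {c x y} → 0# ≤ c → x ≤ y → x * c ≤ y * c
  *-monoʳ-≤ 0≤c x≤y = subst₂ _≤_ (*-comm _ _) (*-comm _ _) (*-monoˡ-≤ 0≤c x≤y)

  *-cancelˡ-≤ : ∀ {c x y} → 0# < c → c * x ≤ c * y → x ≤ y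
  *-cancelˡ-≤ 0<c cx≤cy = ≮⇒≥ (λ y<x → <⇒≱ (*-monoˡ-< 0<c y<x) cx≤cy)

  *-cancelˡ-< : ∀ {c x y} → 0# < c → c * x < c * y → x < y
  *-cancelˡ-< 0<c cx<cy = ≰⇒> (λ y≤x → <⇒≱ cx<cy (*-monoˡ-≤ (inj₁ 0<c) y≤x))

  0<1 : 0# < 1#
  0<1 with compare 0# 1#
  ... | tri< 0<1 _ _ = 0<1
  ... | tri≈ _ 0≡1 _ = ⊥-elim (0≢1 0≡1)
  ... | tri> _ _ 1<0 = ⊥-elim (<-asym 1<0 (subst (0# <_) (solve 0 ((:- :1) :* (:- :1) := :1) refl) (*-pos 0<-1 0<-1)))
    where
    0<-1 : 0# < - 1#
    0<-1 = <-from₁ 1<0 (solve 0 ((:- :1) :- :0 := :0 :- :1) refl)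

  0<2 : 0# < 2#
  0<2 = subst (_< 2#) (+-identityˡ 0#) (+-mono-<-≤ 0<1 (inj₁ 0<1))

  pos⇒≢0 : ∀ {x} → 0# < x → x ≢ 0#
  pos⇒≢0 0<x refl = <-irrefl refl 0<x

  *-inverseʳ : ∀ {x} → 0# < x → x * x ⁻¹ ≡ 1#
  *-inverseʳ 0<x = ⁻¹-inverseʳ _ (pos⇒≢0 0<x)

  ⁻¹-pos : ∀ {x} → 0# < x → 0# < x ⁻¹
  ⁻¹-pos {x} 0<x = *-cancelˡ-< 0<x (subst₂ _<_ (sym (zeroʳ x)) (sym (*-inverseʳ 0<x)) 0<1)

  *-cancel-/ : ∀ {x} y → 0# < x → x * (y / x) ≡ y
  *-cancel-/ {x} y 0<x = trans (solve 3 (λ x y i → x :* (y :* i) := y :* (x :* i)) refl x y (x ⁻¹))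
    (trans (cong (y *_) (*-inverseʳ 0<x)) (*-identityʳ y))

  ≤/⇒*≤ : ∀ {x y z} → 0# < z → x ≤ y / z → x * z ≤ y
  ≤/⇒*≤ {x} {y} {z} 0<z x≤y/z = subst₂ _≤_ (*-comm z x) (*-cancel-/ y 0<z) (*-monoˡ-≤ (inj₁ 0<z) x≤y/z)

  *≤⇒≤/ : ∀ {x y z} → 0# < z → x * z ≤ y → x ≤ y / z
  *≤⇒≤/ {x} {y} {z} 0<z xz≤y = *-cancelˡ-≤ 0<z (subst₂ _≤_ (*-comm x z) (sym (*-cancel-/ y 0<z)) xz≤y)

  ≤*⇒/≤ : ∀ {x y z} → 0# < z → y ≤ x * z → y / z ≤ x
  ≤*⇒/≤ {x} {y} {z} 0<z y≤xz = *-cancelˡ-≤ 0<z (subst₂ _≤_ (sym (*-cancel-/ y 0<z)) (*-comm x z) y≤xz)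

  /-pos : ∀ {x y} → 0# < x → 0# < y → 0# < x / y
  /-pos 0<x 0<y = *-pos 0<x (⁻¹-pos 0<y)

  -- If `y < x`, then half of the gap `x - y` is an `ε` that violates the hypothesis.
  ≤-by-ε : ∀ {x y} → (∀ ε → 0# < ε → x ≤ y + ε) → x ≤ y
  ≤-by-ε {x} {y} x≤y+ε = ≮⇒≥ λ y<x →
    let δ = x - y
        ε = δ / 2#
        0<ε = /-pos (x<y⇒0<y-x y<x) 0<2
        ε+ε = trans (solve 1 (λ e → e :+ e := :2 :* e) refl ε) (*-cancel-/ δ 0<2)
    in <⇒≱ 0<ε (≤-from₁ (x≤y+ε ε 0<ε)
         (trans (solve 1 (λ e → :0 :- e := e :- (e :+ e)) refl ε)
           (trans (cong (λ z → ε - z) ε+ε)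
             (solve 3 (λ e x y → e :- (x :- y) := (y :+ e) :- x) refl ε x y))))

  sup-ub : ∀ {ℓ} {P : Pred ℝ ℓ} {s} → IsSup P s → ∀ {x} → x ∈ P → x ≤ s
  sup-ub isSup = proj₁ isSup

  sup-least : ∀ {ℓ} {P : Pred ℝ ℓ} {s u} → IsSup P s → UpperBound P u → s ≤ u
  sup-least (_ , approx) ub = ≮⇒≥ λ u<s →
    let (x , x∈P , u<x) = approx _ u<s in <⇒≱ u<x (ub x∈P)

  module _ {ℓ} {P : Pred ℝ ℓ} {l : ℝ} (inhabited : Satisfiable P) (lb : ∀ {x} → x ∈ P → l ≤ x) where
    private
      isSup : IsSup (λ x → - x ∈ P) (⨆ (λ x → - x ∈ P))
      isSup = ⨆-isSup _
        (- proj₁ inhabited , subst P (sym (-‿involutive _)) (proj₂ inhabited))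
        (- l , λ -x∈P → subst (_≤ - l) (-‿involutive _) (neg-mono-≤ (lb -x∈P)))

    ⨅-lb : ∀ {x} → x ∈ P → ⨅ P ≤ x
    ⨅-lb {x} x∈P = subst (⨅ P ≤_) (-‿involutive x)
      (neg-mono-≤ (sup-ub isSup (subst P (sym (-‿involutive x)) x∈P)))

    ⨅-approx : ∀ {y} → ⨅ P < y → ∃[ x ] (x ∈ P × x < y)
    ⨅-approx {y} ⨅<y =
      let (z , -z∈P , -y<z) = proj₂ isSup (- y) (subst (- y <_) (-‿involutive _) (neg-mono-< ⨅<y))
      in - z , -z∈P , subst (- z <_) (-‿involutive y) (neg-mono-< -y<z)

    ⨅-greatest : ∀ {u} → (∀ {x} → x ∈ P → u ≤ x) → u ≤ ⨅ P
    ⨅-greatest u-lb = ≮⇒≥ λ ⨅<u → let (x , x∈P , x<u) = ⨅-approx ⨅<u in <⇒≱ x<u (u-lb x∈P)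

  sum-mono-≤ : ∀ {n} {f g : Fin n → ℝ} → (∀ i → f i ≤ g i) → sum f ≤ sum g
  sum-mono-≤ {zero}  f≤g = ≤-refl
  sum-mono-≤ {suc n} f≤g = +-mono-≤ (f≤g zero) (sum-mono-≤ (f≤g ∘ suc))

  sum-mono-< : ∀ {n} {f g : Fin n → ℝ} → (∀ i → f i ≤ g i) → ∀ i → f i < g i → sum f < sum g
  sum-mono-< f≤g zero    f<g = +-mono-<-≤ f<g (sum-mono-≤ (f≤g ∘ suc))
  sum-mono-< f≤g (suc i) f<g = +-mono-≤-< (f≤g zero) (sum-mono-< (f≤g ∘ suc) i f<g)

-- Countable covers and Lebesgue outer measure

module OuterMeasure (𝓡 : CompleteOrderedField) where
  open CompleteOrderedField 𝓡
  open Lebesgue 𝓡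
  open OrderedField 𝓡

  partialSum : (ℕ → ℝ) → ℕ → ℝ
  partialSum f n = sum {n} (f ∘ toℕ)

  partialSum-mono-≤ : ∀ {f g : ℕ → ℝ} → (∀ k → f k ≤ g k) → ∀ n → partialSum f n ≤ partialSum g n
  partialSum-mono-≤ f≤g n = sum-mono-≤ {n} (f≤g ∘ toℕ)

  partialSum-≥0 : ∀ {f : ℕ → ℝ} → (∀ k → 0# ≤ f k) → ∀ n → 0# ≤ partialSum f n
  partialSum-≥0 {f} 0≤f zero    = ≤-refl
  partialSum-≥0 {f} 0≤f (suc n) = subst (_≤ partialSum f (suc n)) (+-identityˡ 0#) (+-mono-≤ (0≤f 0) (partialSum-≥0 (0≤f ∘ suc) n))

  partialSum-monoʳ-≤ : ∀ {f : ℕ → ℝ} → (∀ k → 0# ≤ f k) → ∀ {m n} → m ℕ.≤ n → partialSum f m ≤ partialSum f n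
  partialSum-monoʳ-≤ 0≤f {n = n} z≤n = partialSum-≥0 0≤f n
  partialSum-monoʳ-≤ 0≤f (s≤s m≤n)   = +-monoʳ-≤ _ (partialSum-monoʳ-≤ (0≤f ∘ suc) m≤n)

  partialSum-0 : ∀ n → partialSum (λ _ → 0#) n ≡ 0#
  partialSum-0 zero    = refl
  partialSum-0 (suc n) = trans (+-identityˡ _) (partialSum-0 n)

  -- The term that gains `δ` may lie beyond the first `n`. The `m` produced is the maximum of `n`
  -- and `k + 1`, which keeps that term inside the partial sum of `g`.
  partialSum-gain : ∀ {f g : ℕ → ℝ} {δ} → (∀ k → 0# ≤ f k) → (∀ k → f k ≤ g k) →
    ∀ k → f k + δ ≤ g k → ∀ n → ∃[ m ] partialSum f n + δ ≤ partialSum g m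
  partialSum-gain {f} {g} {δ} 0≤f f≤g zero gain zero = 1 ,
    ≤-from₂ (0≤f 0) gain
      (solve 3 (λ f g δ → (g :+ :0) :- (:0 :+ δ) := (f :- :0) :+ (g :- (f :+ δ))) refl (f 0) (g 0) δ)
  partialSum-gain {f} {g} {δ} 0≤f f≤g zero gain (suc n) = suc n ,
    ≤-from₂ gain (partialSum-mono-≤ (f≤g ∘ suc) n)
      (solve 5 (λ f g δ s t → (g :+ t) :- ((f :+ s) :+ δ) := (g :- (f :+ δ)) :+ (t :- s)) refl
        (f 0) (g 0) δ (partialSum (f ∘ suc) n) (partialSum (g ∘ suc) n))
  partialSum-gain {f} {g} {δ} 0≤f f≤g (suc k) gain zero =
    let (m , ≤m) = partialSum-gain (0≤f ∘ suc) (f≤g ∘ suc) k gain zero in suc m ,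
    ≤-from₂ (≤-trans (0≤f 0) (f≤g 0)) ≤m
      (solve 3 (λ g δ t → (g :+ t) :- (:0 :+ δ) := (g :- :0) :+ (t :- (:0 :+ δ))) refl
        (g 0) δ (partialSum (g ∘ suc) m))
  partialSum-gain {f} {g} {δ} 0≤f f≤g (suc k) gain (suc n) =
    let (m , ≤m) = partialSum-gain (0≤f ∘ suc) (f≤g ∘ suc) k gain n in suc m ,
    ≤-from₂ (f≤g 0) ≤m
      (solve 5 (λ f g δ s t → (g :+ t) :- ((f :+ s) :+ δ) := (g :- f) :+ (t :- (s :+ δ))) refl
        (f 0) (g 0) δ (partialSum (f ∘ suc) n) (partialSum (g ∘ suc) m))

  Interval : Set
  Interval = ℝ × ℝ

  len : Interval → ℝ
  len (a , b) = b - a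

  Ordered : Interval → Set
  Ordered (a , b) = a ≤ b

  open⟨_⟩ : Interval → Pred ℝ 0ℓ
  open⟨ a , b ⟩ x = a < x × x < b

  -- Only an upper bound `V` on the partial sums is kept, where `CoverLength` asks for their
  -- supremum. Covers can then be restricted, merged and clipped without computing a new supremum;
  -- `coverLength⇒cover` and `cover⇒coverLength` translate.
  record Cover (A : Pred ℝ 0ℓ) (V : ℝ) : Set where
    field
      interval : ℕ → Interval
      ordered  : ∀ k → Ordered (interval k)
      covers   : ∀ {x} → x ∈ A → ∃[ k ] x ∈ open⟨ interval k ⟩
      total    : ∀ n → partialSum (len ∘ interval) n ≤ V

  open Cover

  cover-⊆ : ∀ {A B V} → A ⊆ B → Cover B V → Cover A V
  cover-⊆ A⊆B C = record
    { interval = interval C ; ordered = ordered C ; covers = λ x∈A → covers C (A⊆B x∈A) ; total = total C }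

  cover-≤ : ∀ {A V W} → V ≤ W → Cover A V → Cover A W
  cover-≤ V≤W C = record
    { interval = interval C ; ordered = ordered C ; covers = covers C ; total = λ n → ≤-trans (total C n) V≤W }

  cover≥0 : ∀ {A V} → Cover A V → 0# ≤ V
  cover≥0 C = total C 0

  coverLength⇒cover : ∀ {A v} → CoverLength A v → Cover A v
  coverLength⇒cover (a , b , a≤b , covers , isSup) = record
    { interval = λ k → a k , b k
    ; ordered  = a≤b
    ; covers   = covers
    ; total    = λ n → sup-ub isSup (n , refl)
    }

  cover⇒coverLength : ∀ {A V} → Cover A V → ∃[ v ] (v ∈ CoverLength A × v ≤ V)
  cover⇒coverLength {A} {V} C =
    _ , (proj₁ ∘ interval C , proj₂ ∘ interval C , ordered C , covers C , isSup) , sup-least isSup ub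
    where
    PartialSums : Pred ℝ 0ℓ
    PartialSums s = ∃[ n ] s ≡ partialSum (len ∘ interval C) n
    ub : UpperBound PartialSums V
    ub (n , refl) = total C n
    isSup : IsSup PartialSums (⨆ PartialSums)
    isSup = ⨆-isSup PartialSums (0# , 0 , refl) (V , ub)

  finite : ∀ {A V} → Cover A V → FiniteOuterMeasure A
  finite C = let (v , v∈ , _) = cover⇒coverLength C in v , v∈

  finite-⊆ : ∀ {A B} → A ⊆ B → FiniteOuterMeasure B → FiniteOuterMeasure A
  finite-⊆ A⊆B (v , v∈) = finite (cover-⊆ A⊆B (coverLength⇒cover v∈))

  μ : Pred ℝ 0ℓ → ℝ
  μ = outerMeasure

  coverLength≥0 : ∀ {A v} → v ∈ CoverLength A → 0# ≤ v
  coverLength≥0 v∈ = cover≥0 (coverLength⇒cover v∈)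

  cover⇒μ≤ : ∀ {A V} → Cover A V → μ A ≤ V
  cover⇒μ≤ C = let (v , v∈ , v≤V) = cover⇒coverLength C in
    ≤-trans (⨅-lb (v , v∈) coverLength≥0 v∈) v≤V

  μ-approx : ∀ {A} → FiniteOuterMeasure A → ∀ ε → 0# < ε → Cover A (μ A + ε)
  μ-approx {A} fin ε 0<ε =
    let (v , v∈ , v<) = ⨅-approx fin coverLength≥0 (x<x+y (μ A) 0<ε)
    in cover-≤ (inj₁ v<) (coverLength⇒cover v∈)

  μ≥0 : ∀ {A} → FiniteOuterMeasure A → 0# ≤ μ A
  μ≥0 fin = ⨅-greatest fin coverLength≥0 coverLength≥0

  μ-mono : ∀ {A B} → FiniteOuterMeasure B → A ⊆ B → μ A ≤ μ B
  μ-mono fin A⊆B = ≤-by-ε λ ε 0<ε → cover⇒μ≤ (cover-⊆ A⊆B (μ-approx fin ε 0<ε))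

  μ-cong : ∀ {A B} → FiniteOuterMeasure A → A ⊆ B → B ⊆ A → μ A ≡ μ B
  μ-cong fin A⊆B B⊆A = ≤-antisym (μ-mono (finite-⊆ B⊆A fin) A⊆B) (μ-mono fin B⊆A)

  emptyCover : ∀ {A} → (∀ {x} → x ∉ A) → Cover A 0#
  emptyCover A-empty = record
    { interval = λ _ → 0# , 0#
    ; ordered  = λ _ → ≤-refl
    ; covers   = λ x∈A → ⊥-elim (A-empty x∈A)
    ; total    = λ n → inj₂ (trans (cong-partialSum n) (partialSum-0 n))
    }
    where
    cong-partialSum : ∀ n → partialSum (λ _ → 0# - 0#) n ≡ partialSum (λ _ → 0#) n
    cong-partialSum n = cong (λ z → partialSum (λ _ → z) n) (solve 0 (:0 :- :0 := :0) refl)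

  μ-empty : ∀ {A} → (∀ {x} → x ∉ A) → μ A ≡ 0#
  μ-empty A-empty = ≤-antisym (cover⇒μ≤ (emptyCover A-empty)) (μ≥0 (finite (emptyCover A-empty)))

  -- Measure of closed intervals, and subadditivity

  Icc : ℝ → ℝ → Pred ℝ 0ℓ
  Icc a b x = a ≤ x × x ≤ b

  -- Covering intervals are open, so `[a , b]` is widened by `ε` at each end; degenerate intervals
  -- fill the rest of the sequence.
  Icc-cover : ∀ {a b} → a ≤ b → ∀ ε → 0# < ε → Cover (Icc a b) ((b - a) + (ε + ε))
  Icc-cover {a} {b} a≤b ε 0<ε = record
    { interval = interval′
    ; ordered  = ordered′
    ; covers   = λ (a≤x , x≤b) → 0 , <-≤-trans a-ε<a a≤x , ≤-<-trans x≤b b<b+ε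
    ; total    = total′
    }
    where
    a-ε<a : a - ε < a
    a-ε<a = <-from₁ 0<ε (solve 2 (λ a e → a :- (a :- e) := e :- :0) refl a ε)
    b<b+ε : b < b + ε
    b<b+ε = x<x+y b 0<ε
    interval′ : ℕ → Interval
    interval′ zero    = a - ε , b + ε
    interval′ (suc k) = 0# , 0#
    ordered′ : ∀ k → Ordered (interval′ k)
    ordered′ zero    = inj₁ (<-trans (<-≤-trans a-ε<a a≤b) b<b+ε)
    ordered′ (suc k) = ≤-refl
    0≤V : 0# ≤ (b - a) + (ε + ε)
    0≤V = ≤-from₂ (x≤y⇒0≤y-x a≤b) (+-mono-≤ (inj₁ 0<ε) (inj₁ 0<ε))
      (solve 2 (λ l e → (l :+ (e :+ e)) :- :0 := (l :- :0) :+ ((e :+ e) :- (:0 :+ :0))) refl (b - a) ε)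
    total′ : ∀ n → partialSum (len ∘ interval′) n ≤ (b - a) + (ε + ε)
    total′ zero    = 0≤V
    -- After index `0` the sequence is that of `emptyCover`, whose partial sums are at most `0#`.
    total′ (suc n) = ≤-trans (+-monoʳ-≤ _ (total (emptyCover {∅} (λ ())) n))
      (inj₂ (solve 3 (λ a b e → (b :+ e) :- (a :- e) :+ :0 := (b :- a) :+ (e :+ e)) refl a b ε))

  Icc-finite : ∀ {a b} → FiniteOuterMeasure (Icc a b)
  Icc-finite {a} {b} with <-or-≥ b a
  ... | inj₁ b<a = finite (emptyCover λ (a≤x , x≤b) → <⇒≱ b<a (≤-trans a≤x x≤b))
  ... | inj₂ a≤b = finite (Icc-cover a≤b 1# 0<1)

  μ-Icc-≤ : ∀ {a b} → a ≤ b → μ (Icc a b) ≤ b - a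
  μ-Icc-≤ {a} {b} a≤b = ≤-by-ε λ δ 0<δ → subst (λ z → μ (Icc a b) ≤ (b - a) + z) (halves δ)
    (cover⇒μ≤ (Icc-cover a≤b (δ / 2#) (/-pos 0<δ 0<2)))
    where
    halves : ∀ δ → δ / 2# + δ / 2# ≡ δ
    halves δ = trans (solve 1 (λ e → e :+ e := :2 :* e) refl (δ / 2#)) (*-cancel-/ δ 0<2)

  -- The part of the interval to the left of `x`. An interval wholly to the right collapses to a
  -- degenerate one at `x`, so clipping never produces a disordered pair.
  clipˡ : ℝ → Interval → Interval
  clipˡ x (a , b) = a ⊓ x , b ⊓ x

  clipʳ : ℝ → Interval → Interval
  clipʳ x (a , b) = a ⊔ x , b ⊔ x

  clipˡ-ordered : ∀ x {I} → Ordered I → Ordered (clipˡ x I)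
  clipˡ-ordered x a≤b = ⊓-monoˡ-≤ x a≤b

  clipʳ-ordered : ∀ x {I} → Ordered I → Ordered (clipʳ x I)
  clipʳ-ordered x a≤b = ⊔-monoˡ-≤ x a≤b

  clip-len : ∀ x I → len (clipˡ x I) + len (clipʳ x I) ≡ len I
  clip-len x (a , b) = trans
    (solve 4 (λ p q s t → (q :- p) :+ (t :- s) := (q :+ t) :- (p :+ s)) refl (a ⊓ x) (b ⊓ x) (a ⊔ x) (b ⊔ x))
    (trans (cong₂ _-_ (min+max b) (min+max a)) (solve 3 (λ a b x → (b :+ x) :- (a :+ x) := b :- a) refl a b x))
    where
    min+max : ∀ y → (y ⊓ x) + (y ⊔ x) ≡ y + x
    min+max y =
      [ (λ y≤x → cong₂ _+_ (x≤y⇒x⊓y≈x y≤x) (x≤y⇒x⊔y≈y y≤x))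
      , (λ x≤y → trans (cong₂ _+_ (x≤y⇒y⊓x≈x x≤y) (x≤y⇒y⊔x≈y x≤y)) (+-comm x y))
      ]′ (≤-total y x)

  clipˡ-len-≤ : ∀ x {I} → Ordered I → len (clipˡ x I) ≤ len I
  clipˡ-len-≤ x {I} ord = ≤-from₁ (x≤y⇒0≤y-x (clipʳ-ordered x ord))
    (trans (cong (_- len (clipˡ x I)) (sym (clip-len x I))) (solve 2 (λ l r → (l :+ r) :- l := r :- :0) refl (len (clipˡ x I)) (len (clipʳ x I))))

  clipˡ-clipˡ : ∀ {x y} I → x ≤ y → clipˡ x (clipˡ y I) ≡ clipˡ x I
  clipˡ-clipˡ {x} {y} (a , b) x≤y = cong₂ _,_ (assoc a) (assoc b)
    where
    assoc : ∀ z → (z ⊓ y) ⊓ x ≡ z ⊓ x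
    assoc z = trans (⊓-assoc z y x) (cong (z ⊓_) (x≤y⇒y⊓x≈x x≤y))

  clipˡ-len-mono : ∀ {x y} I → Ordered I → x ≤ y → len (clipˡ x I) ≤ len (clipˡ y I)
  clipˡ-len-mono {x} {y} I ord x≤y =
    subst (λ K → len K ≤ len (clipˡ y I)) (clipˡ-clipˡ I x≤y) (clipˡ-len-≤ x {clipˡ y I} (clipˡ-ordered y {I} ord))

  clipˡ-len-gain : ∀ {x y} I → proj₁ I ≤ x → x ≤ y → y ≤ proj₂ I → len (clipˡ x I) + (y - x) ≡ len (clipˡ y I)
  clipˡ-len-gain {x} {y} (a , b) a≤x x≤y y≤b
    rewrite x≤y⇒x⊓y≈x a≤x | x≤y⇒x⊓y≈x (≤-trans a≤x x≤y) | x≤y⇒y⊓x≈x y≤b | x≤y⇒y⊓x≈x (≤-trans x≤y y≤b) =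
    solve 3 (λ a x y → (x :- a) :+ (y :- x) := y :- a) refl a x y

  -- A compactness argument: the supremum of the points x such that finitely
  -- many intervals, clipped at x, already have total length x - a, is b.
  Icc-cover-≥ : ∀ {a b V} → a ≤ b → Cover (Icc a b) V → b - a ≤ V
  Icc-cover-≥ {a} {b} {V} a≤b C = conclude (b-reached (≮⇒≥ s-maximal))
    where
    I = interval C
    F : ℝ → ℕ → ℝ
    F x = partialSum (λ k → len (clipˡ x (I k)))
    Reached : Pred ℝ 0ℓ
    Reached x = (a ≤ x × x ≤ b) × ∃[ n ] x - a ≤ F x n
    a∈Reached : a ∈ Reached
    a∈Reached = (≤-refl , a≤b) , 0 , inj₂ (solve 1 (λ a → a :- a := :0) refl a)
    s = ⨆ Reached
    isSup : IsSup Reached s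
    isSup = ⨆-isSup Reached (a , a∈Reached) (b , λ ((_ , x≤b) , _) → x≤b)
    a≤s : a ≤ s
    a≤s = sup-ub isSup a∈Reached
    s≤b : s ≤ b
    s≤b = sup-least isSup λ ((_ , x≤b) , _) → x≤b
    -- The cover has an open interval around the supremum `s`. It contains reached points
    -- arbitrarily close to `s` on the left and, when `s < b`, points of `[a , b]` beyond `s`.
    k = proj₁ (covers C (a≤s , s≤b))
    s∈I : s ∈ open⟨ I k ⟩
    s∈I = proj₂ (covers C (a≤s , s≤b))
    -- Moving the clipping point from `x` to `y` inside `I k` lengthens the `k`-th term by exactly
    -- `y - x` and shortens no other term.
    extend : ∀ {x y} → x ∈ Reached → proj₁ (I k) < x → x ≤ y → y ≤ proj₂ (I k) → y ≤ b → y ∈ Reached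
    extend {x} {y} ((a≤x , _) , n , ≤F) aₖ<x x≤y y≤bₖ y≤b =
      let (m , F≤F) = partialSum-gain
            (λ i → x≤y⇒0≤y-x (clipˡ-ordered x {I i} (ordered C i)))
            (λ i → clipˡ-len-mono (I i) (ordered C i) x≤y)
            k (inj₂ (clipˡ-len-gain (I k) (inj₁ aₖ<x) x≤y y≤bₖ)) n
      in (≤-trans a≤x x≤y , y≤b) , m ,
         ≤-from₂ ≤F F≤F (solve 5 (λ a x y f g → g :- (y :- a) := (f :- (x :- a)) :+ (g :- (f :+ (y :- x)))) refl a x y (F x n) (F y m))
    reached : ∀ y → y ≤ b → y ≤ proj₂ (I k) → s ≤ y → y ∈ Reached
    reached y y≤b y≤bₖ s≤y =
      let (x , x∈ , aₖ<x) = proj₂ isSup (proj₁ (I k)) (proj₁ s∈I)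
      in extend x∈ aₖ<x (≤-trans (sup-ub isSup x∈) s≤y) y≤bₖ y≤b
    s-maximal : ¬ s < b
    s-maximal s<b =
      -- A point beyond `s` that is still in `[a , b]` and not past the right end of `I k`; it would
      -- be reached too.
      let y = b ⊓ proj₂ (I k)
          s<y = <-⊓-glb s<b (proj₂ s∈I)
      in <⇒≱ s<y (sup-ub isSup (reached y (x⊓y≤x b _) (x⊓y≤y b _) (inj₁ s<y)))
    b-reached : b ≤ s → b ∈ Reached
    b-reached b≤s = reached b ≤-refl (≤-trans b≤s (inj₁ (proj₂ s∈I))) s≤b
    conclude : b ∈ Reached → b - a ≤ V
    conclude (_ , n , ≤F) = ≤-trans ≤F (≤-trans (partialSum-mono-≤ (λ i → clipˡ-len-≤ b {I i} (ordered C i)) n) (total C n))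

  μ-Icc-≥ : ∀ {a b} → a ≤ b → b - a ≤ μ (Icc a b)
  μ-Icc-≥ a≤b = ≤-by-ε λ ε 0<ε → Icc-cover-≥ a≤b (μ-approx Icc-finite ε 0<ε)

  -- The two sequences swap roles at every step, which avoids parity arithmetic. For the same reason
  -- the two index lemmas `interleave-ˡ` and `interleave-ʳ` are mutually recursive.
  interleave : ∀ {X : Set} → (ℕ → X) → (ℕ → X) → ℕ → X
  interleave f g zero    = f zero
  interleave f g (suc n) = interleave g (f ∘ suc) n

  interleave-∀ : ∀ {X : Set} (P : X → Set) {f g} → (∀ k → P (f k)) → (∀ k → P (g k)) → ∀ n → P (interleave f g n)
  interleave-∀ P Pf Pg zero    = Pf zero
  interleave-∀ P Pf Pg (suc n) = interleave-∀ P Pg (Pf ∘ suc) n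

  interleave-ˡ : ∀ {X : Set} (f g : ℕ → X) k → ∃[ n ] interleave f g n ≡ f k
  interleave-ʳ : ∀ {X : Set} (f g : ℕ → X) k → ∃[ n ] interleave f g n ≡ g k
  interleave-ˡ f g zero    = zero , refl
  interleave-ˡ f g (suc k) = let (n , eq) = interleave-ʳ g (f ∘ suc) k in suc n , eq
  interleave-ʳ f g k = let (n , eq) = interleave-ˡ g (f ∘ suc) k in suc n , eq

  partialSum-interleave : ∀ {X : Set} (h : X → ℝ) f g n →
    ∃[ p ] ∃[ q ] partialSum (h ∘ interleave f g) n ≡ partialSum (h ∘ f) p + partialSum (h ∘ g) q
  partialSum-interleave h f g zero    = 0 , 0 , sym (+-identityˡ 0#)
  partialSum-interleave h f g (suc n) =
    let (p , q , eq) = partialSum-interleave h g (f ∘ suc) n in suc q , p ,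
    trans (cong (λ z → h (f 0) + z) eq)
      (solve 3 (λ a b c → a :+ (b :+ c) := (a :+ c) :+ b) refl (h (f 0)) (partialSum (h ∘ g) p) (partialSum (h ∘ f ∘ suc) q))

  cover-∪ : ∀ {A B V W} → Cover A V → Cover B W → Cover (A ∪ B) (V + W)
  cover-∪ {A} {B} {V} {W} C D = record
    { interval = I
    ; ordered  = interleave-∀ Ordered (ordered C) (ordered D)
    ; covers   = covers′
    ; total    = total′
    }
    where
    I = interleave (interval C) (interval D)
    covers′ : ∀ {x} → x ∈ A ∪ B → ∃[ k ] x ∈ open⟨ I k ⟩
    covers′ {x} (inj₁ x∈A) =
      let (k , x∈k) = covers C x∈A ; (n , eq) = interleave-ˡ (interval C) (interval D) k
      in n , subst (λ K → x ∈ open⟨ K ⟩) (sym eq) x∈k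
    covers′ {x} (inj₂ x∈B) =
      let (k , x∈k) = covers D x∈B ; (n , eq) = interleave-ʳ (interval C) (interval D) k
      in n , subst (λ K → x ∈ open⟨ K ⟩) (sym eq) x∈k
    total′ : ∀ n → partialSum (len ∘ I) n ≤ V + W
    total′ n = let (p , q , eq) = partialSum-interleave len (interval C) (interval D) n
      in subst (_≤ V + W) (sym eq) (+-mono-≤ (total C p) (total D q))

  μ-subadditive : ∀ {A B C} → FiniteOuterMeasure B → FiniteOuterMeasure C → A ⊆ B ∪ C → μ A ≤ μ B + μ C
  μ-subadditive {A} {B} {C} finB finC A⊆ = ≤-by-ε λ δ 0<δ → ≤-by-ε λ ε 0<ε →
    subst (μ A ≤_) (solve 4 (λ b c d e → (b :+ d) :+ (c :+ e) := ((b :+ c) :+ d) :+ e) refl (μ B) (μ C) δ ε)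
      (cover⇒μ≤ (cover-⊆ A⊆ (cover-∪ (μ-approx finB δ 0<δ) (μ-approx finC ε 0<ε))))

  -- Induction peels off `B zero`. The remainder is kept as a subset of `A`, so its finiteness comes
  -- from `A` and no finite union has to be bounded.
  μ-subadditive-Fin : ∀ {n A} {B : Fin n → Pred ℝ 0ℓ} → FiniteOuterMeasure A → (∀ i → FiniteOuterMeasure (B i)) →
    (∀ {x} → x ∈ A → ∃[ i ] x ∈ B i) → μ A ≤ sum (λ i → μ (B i))
  μ-subadditive-Fin {zero} finA finB A⊆ = inj₂ (μ-empty λ x∈A → Fin.¬Fin0 (proj₁ (A⊆ x∈A)))
  μ-subadditive-Fin {suc n} {A} {B} finA finB A⊆ =
    ≤-trans (μ-subadditive (finB zero) finRest λ x∈A → split x∈A (A⊆ x∈A))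
      (+-monoʳ-≤ _ (μ-subadditive-Fin finRest (finB ∘ suc) proj₂))
    where
    Rest : Pred ℝ 0ℓ
    Rest x = x ∈ A × ∃[ i ] x ∈ B (suc i)
    finRest : FiniteOuterMeasure Rest
    finRest = finite-⊆ proj₁ finA
    split : ∀ {x} → x ∈ A → ∃[ i ] x ∈ B i → x ∈ B zero ∪ Rest
    split x∈A (zero  , x∈B) = inj₁ x∈B
    split x∈A (suc i , x∈B) = inj₂ (x∈A , i , x∈B)

  -- Carathéodory measurability of half-lines, intersections and disjoint families

  sum-+ : ∀ {n} (f g : Fin n → ℝ) → sum (λ i → f i + g i) ≡ sum f + sum g
  sum-+ = CommutativeMonoidSum.∑-distrib-+ (CommutativeRing.+-commutativeMonoid commutativeRing)

  μ-Icc-point : ∀ c → μ (Icc c c) ≤ 0#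
  μ-Icc-point c = subst (μ (Icc c c) ≤_) (solve 1 (λ c → c :- c := :0) refl c) (μ-Icc-≤ ≤-refl)

  -- Clipping every interval at `c` on both sides gives covers of the two parts, and by `clip-len`
  -- their lengths add up to the original ones. The point `c` is left out because no clipped open
  -- interval contains it.
  cover-split : ∀ c {A V} → Cover A V → μ (A ∩ (_< c)) + μ (A ∩ (c <_)) ≤ V
  cover-split c {A} {V} C = ≤-from₁ μʳ≤
    (solve 3 (λ l r v → v :- (l :+ r) := (v :- l) :- r) refl (μ (A ∩ (_< c))) (μ (A ∩ (c <_))) V)
    where
    L R : ℕ → Interval
    L = clipˡ c ∘ interval C
    R = clipʳ c ∘ interval C
    L-ordered : ∀ k → Ordered (L k)
    L-ordered k = clipˡ-ordered c {interval C k} (ordered C k)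
    R-ordered : ∀ k → Ordered (R k)
    R-ordered k = clipʳ-ordered c {interval C k} (ordered C k)
    -- The indices are independent because each measure is bounded against a fixed partial sum of
    -- the other side. Raising both to `p + q` allows the terms to be paired.
    both : ∀ p q → partialSum (len ∘ L) p + partialSum (len ∘ R) q ≤ V
    both p q = begin
      partialSum (len ∘ L) p + partialSum (len ∘ R) q
        ≤⟨ +-mono-≤ (partialSum-monoʳ-≤ (λ k → x≤y⇒0≤y-x (L-ordered k)) (ℕ.m≤m+n p q))
                    (partialSum-monoʳ-≤ (λ k → x≤y⇒0≤y-x (R-ordered k)) (ℕ.m≤n+m q p)) ⟩
      partialSum (len ∘ L) (p ℕ.+ q) + partialSum (len ∘ R) (p ℕ.+ q)
        ≡⟨ sum-+ {p ℕ.+ q} (len ∘ L ∘ toℕ) (len ∘ R ∘ toℕ) ⟨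
      partialSum (λ k → len (L k) + len (R k)) (p ℕ.+ q)
        ≤⟨ partialSum-mono-≤ (λ k → inj₂ (clip-len c (interval C k))) (p ℕ.+ q) ⟩
      partialSum (len ∘ interval C) (p ℕ.+ q)
        ≤⟨ total C (p ℕ.+ q) ⟩
      V ∎
      where open ≤-Reasoning
    μˡ≤ : ∀ q → μ (A ∩ (_< c)) ≤ V - partialSum (len ∘ R) q
    μˡ≤ q = cover⇒μ≤ record
      { interval = L
      ; ordered  = L-ordered
      ; covers   = λ (x∈A , x<c) → let (k , a<x , x<b) = covers C x∈A in
                     k , ≤-<-trans (x⊓y≤x _ c) a<x , <-⊓-glb x<b x<c
      ; total    = λ p → ≤-from₁ (both p q)
                     (solve 3 (λ l r v → (v :- r) :- l := v :- (l :+ r)) refl (partialSum (len ∘ L) p) (partialSum (len ∘ R) q) V)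
      }
    μʳ≤ : μ (A ∩ (c <_)) ≤ V - μ (A ∩ (_< c))
    μʳ≤ = cover⇒μ≤ record
      { interval = R
      ; ordered  = R-ordered
      ; covers   = λ (x∈A , c<x) → let (k , a<x , x<b) = covers C x∈A in
                     k , <-⊔-lub a<x c<x , <-≤-trans x<b (x≤x⊔y _ c)
      ; total    = λ q → ≤-from₁ (μˡ≤ q)
                     (solve 3 (λ l r v → (v :- l) :- r := (v :- r) :- l) refl (μ (A ∩ (_< c))) (partialSum (len ∘ R) q) V)
      }

  -- Beyond `cover-split`, the complement of the half-line has only the point `c`, which is null.
  <-measurable : ∀ c → Measurable (_< c)
  <-measurable c A finA = ≤-antisym
    (μ-subadditive (finite-⊆ proj₁ finA) (finite-⊆ proj₁ finA) λ {x} x∈A → split x∈A (<-or-≥ x c))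
    (≤-by-ε λ ε 0<ε → ≤-trans (+-monoʳ-≤ _ μ∖≤) (cover-split c (μ-approx finA ε 0<ε)))
    where
    split : ∀ {x} → x ∈ A → x < c ⊎ c ≤ x → x ∈ (A ∩ (_< c)) ∪ (A ∖ (_< c))
    split x∈A (inj₁ x<c) = inj₁ (x∈A , x<c)
    split x∈A (inj₂ c≤x) = inj₂ (x∈A , λ x<c → <⇒≱ x<c c≤x)
    split′ : ∀ {x} → x ∈ A → c ≤ x → x ∈ (A ∩ (c <_)) ∪ Icc c c
    split′ x∈A (inj₁ c<x)  = inj₁ (x∈A , c<x)
    split′ x∈A (inj₂ refl) = inj₂ (≤-refl , ≤-refl)
    μ∖≤ : μ (A ∖ (_< c)) ≤ μ (A ∩ (c <_))
    μ∖≤ = subst (μ (A ∖ (_< c)) ≤_) (+-identityʳ _)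
      (≤-trans (μ-subadditive (finite-⊆ proj₁ finA) Icc-finite λ (x∈A , x≮c) → split′ x∈A (≮⇒≥ x≮c))
        (+-monoʳ-≤ _ (μ-Icc-point c)))

  -- Cutting `A` by `E`, and then the part in `E` by `F`, leaves three pieces. The two outside
  -- `E ∩ F` are exactly those into which `E` cuts `A ∖ (E ∩ F)`, so the criterion for `E`, read
  -- backwards, reassembles them.
  ∩-measurable : ∀ {E F} → Measurable E → Measurable F → Measurable (E ∩ F)
  ∩-measurable {E} {F} mE mF A finA = begin
    μ A
      ≡⟨ mE A finA ⟩
    μ (A ∩ E) + μ (A ∖ E)
      ≡⟨ cong (_+ μ (A ∖ E)) (mF (A ∩ E) (sub proj₁)) ⟩
    (μ ((A ∩ E) ∩ F) + μ ((A ∩ E) ∖ F)) + μ (A ∖ E)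
      ≡⟨ solve 3 (λ a b c → (a :+ b) :+ c := a :+ (b :+ c)) refl _ _ _ ⟩
    μ ((A ∩ E) ∩ F) + (μ ((A ∩ E) ∖ F) + μ (A ∖ E))
      ≡⟨ cong₂ _+_
           (μ-cong (sub λ ((x∈A , _) , _) → x∈A)
             (λ ((x∈A , x∈E) , x∈F) → x∈A , x∈E , x∈F)
             (λ (x∈A , x∈E , x∈F) → (x∈A , x∈E) , x∈F))
           (cong₂ _+_
             (μ-cong (sub λ ((x∈A , _) , _) → x∈A)
               (λ ((x∈A , x∈E) , x∉F) → (x∈A , λ (_ , x∈F) → x∉F x∈F) , x∈E)
               (λ ((x∈A , x∉E∩F) , x∈E) → (x∈A , x∈E) , λ x∈F → x∉E∩F (x∈E , x∈F)))
             (μ-cong (sub proj₁)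
               (λ (x∈A , x∉E) → (x∈A , λ (x∈E , _) → x∉E x∈E) , x∉E)
               (λ ((x∈A , _) , x∉E) → x∈A , x∉E))) ⟩
    μ (A ∩ (E ∩ F)) + (μ ((A ∖ (E ∩ F)) ∩ E) + μ ((A ∖ (E ∩ F)) ∖ E))
      ≡⟨ cong (μ (A ∩ (E ∩ F)) +_) (mE (A ∖ (E ∩ F)) (sub proj₁)) ⟨
    μ (A ∩ (E ∩ F)) + μ (A ∖ (E ∩ F)) ∎
    where
    open ≡-Reasoning
    sub : ∀ {B} → B ⊆ A → FiniteOuterMeasure B
    sub B⊆A = finite-⊆ B⊆A finA

  -- `E zero` is cut out of `A` by its own criterion. The later sets are disjoint from it, so their
  -- traces on `A` lie in `A ∖ E zero`, where induction applies.
  Σμ≤μ : ∀ {n A} {E : Fin n → Pred ℝ 0ℓ} → FiniteOuterMeasure A → (∀ i → Measurable (E i)) →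
    (∀ i j → i ≢ j → E i ⊥ E j) → sum (λ i → μ (A ∩ E i)) ≤ μ A
  Σμ≤μ {zero} finA mE disjoint = μ≥0 finA
  Σμ≤μ {suc n} {A} {E} finA mE disjoint = begin
    μ (A ∩ E zero) + sum (λ i → μ (A ∩ E (suc i)))
      ≤⟨ +-monoʳ-≤ _ (sum-mono-≤ {n} λ i → μ-mono {A ∩ E (suc i)} {(A ∖ E zero) ∩ E (suc i)} (finite-⊆ (proj₁ ∘ proj₁) finA)
           λ (x∈A , x∈Eᵢ) → (x∈A , λ x∈E₀ → disjoint zero (suc i) (λ ()) (x∈E₀ , x∈Eᵢ)) , x∈Eᵢ) ⟩
    μ (A ∩ E zero) + sum (λ i → μ ((A ∖ E zero) ∩ E (suc i)))
      ≤⟨ +-monoʳ-≤ _ (Σμ≤μ (finite-⊆ proj₁ finA) (mE ∘ suc)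
           λ i j i≢j → disjoint (suc i) (suc j) (i≢j ∘ Fin.suc-injective)) ⟩
    μ (A ∩ E zero) + μ (A ∖ E zero)
      ≡⟨ mE zero A finA ⟨
    μ A ∎
    where open ≤-Reasoning

-- Bounds on the Lebesgue integral

module Integral (𝓡 : CompleteOrderedField) where
  open CompleteOrderedField 𝓡
  open Lebesgue 𝓡
  open OrderedField 𝓡
  open OuterMeasure 𝓡

  *-distribˡ-sum : ∀ {n} c (f : Fin n → ℝ) → c * sum f ≡ sum (λ i → c * f i)
  *-distribˡ-sum = SemiringSum.*-distribˡ-sum semiring

  record BoundedOn (S : Pred ℝ 0ℓ) (f : ℝ → ℝ) (M : ℝ) : Set where
    field
      finiteMeasure : FiniteOuterMeasure S
      0≤M           : 0# ≤ M
      f≤M           : ∀ {x} → x ∈ S → f x ≤ M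

  open BoundedOn

  weightedSum-≤ : ∀ {k M B} {E : Fin k → Pred ℝ 0ℓ} {c : Fin k → ℝ} → FiniteOuterMeasure B → 0# ≤ M →
    (∀ i → Measurable (E i)) → (∀ i j → i ≢ j → E i ⊥ E j) → (∀ i {x} → x ∈ B → x ∈ E i → c i ≤ M) →
    sum (λ i → c i * μ (B ∩ E i)) ≤ M * μ B
  weightedSum-≤ {k} {M} {B} {E} {c} finB 0≤M mE disjoint c≤M = begin
    sum (λ i → c i * μ (B ∩ E i))   ≤⟨ sum-mono-≤ {k} termwise ⟩
    sum (λ i → M * μ (B ∩ E i))     ≡⟨ *-distribˡ-sum M (λ i → μ (B ∩ E i)) ⟨
    M * sum (λ i → μ (B ∩ E i))     ≤⟨ *-monoˡ-≤ 0≤M (Σμ≤μ finB mE disjoint) ⟩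
    M * μ B                         ∎
    where
    open ≤-Reasoning
    termwise : ∀ i → c i * μ (B ∩ E i) ≤ M * μ (B ∩ E i)
    -- This comparison stands in for asking whether `B` meets `E i`: if `c i` exceeds `M`, no point
    -- lies in both, and both sides vanish.
    termwise i with <-or-≥ M (c i)
    ... | inj₂ cᵢ≤M = *-monoʳ-≤ (μ≥0 (finite-⊆ proj₁ finB)) cᵢ≤M
    ... | inj₁ M<cᵢ = inj₂ (trans (cong (c i *_) null) (trans (zeroʳ (c i)) (sym (trans (cong (M *_) null) (zeroʳ M)))))
      where
      null : μ (B ∩ E i) ≡ 0#
      null = μ-empty λ (x∈B , x∈E) → <⇒≱ M<cᵢ (c≤M i x∈B x∈E)

  simple-≤ : ∀ {S f M} → BoundedOn S f M → ∀ {v} → v ∈ SimpleIntegralBelow S f → v ≤ M * μ S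
  simple-≤ {S} {f} {M} bdd (k , E , c , mE , E⊆S , disjoint , 0≤c , c≤f , refl) = ≤-trans
    (sum-mono-≤ {k} λ i → *-monoˡ-≤ (0≤c i) (μ-mono {E i} {S ∩ E i} (finite-⊆ proj₁ (finiteMeasure bdd)) λ x∈E → E⊆S i x∈E , x∈E))
    (weightedSum-≤ (finiteMeasure bdd) (0≤M bdd) mE disjoint λ i x∈S x∈E → ≤-trans (c≤f i x∈E) (f≤M bdd x∈S))

  ∫-isSup : ∀ {S f M} → BoundedOn S f M → IsSup (SimpleIntegralBelow S f) (∫ S f)
  ∫-isSup bdd = ⨆-isSup _
    -- The simple function with no pieces shows that the set of lower integrals is inhabited.
    (0# , 0 , (λ ()) , (λ ()) , (λ ()) , (λ ()) , (λ ()) , (λ ()) , (λ ()) , refl)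
    (_ , simple-≤ bdd)

  ∫-≤ : ∀ {S f M} → BoundedOn S f M → ∫ S f ≤ M * μ S
  ∫-≤ bdd = sup-least (∫-isSup bdd) (simple-≤ bdd)

  ∫-≥ : ∀ {S f M c} → BoundedOn S f M → Measurable S → 0# ≤ c → (∀ {x} → x ∈ S → c ≤ f x) → c * μ S ≤ ∫ S f
  ∫-≥ {S} {f} {M} {c} bdd mS 0≤c c≤f = sup-ub (∫-isSup bdd)
    (1 , (λ _ → S) , (λ _ → c) , (λ _ → mS) , (λ _ x∈S → x∈S) , disjoint , (λ _ → 0≤c) , (λ _ → c≤f) , sym (+-identityʳ _))
    where
    disjoint : ∀ (i j : Fin 1) → i ≢ j → S ⊥ S
    disjoint zero zero i≢j = ⊥-elim (i≢j refl)

  ∫-mono : ∀ {S T f M} → BoundedOn T f M → S ⊆ T → ∫ S f ≤ ∫ T f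
  ∫-mono {S} {T} {f} bdd S⊆T = sup-least
    (∫-isSup record { finiteMeasure = finite-⊆ S⊆T (finiteMeasure bdd) ; 0≤M = 0≤M bdd ; f≤M = λ x∈S → f≤M bdd (S⊆T x∈S) })
    λ (k , E , c , mE , E⊆S , rest) → sup-ub (∫-isSup bdd) (k , E , c , mE , (λ i x∈E → S⊆T (E⊆S i x∈E)) , rest)

  -- A simple function on `S` is cut at `c`. What lies before `c` is again simple and below `f` on
  -- `S′`; the rest is carried by `B` and has values at most `M`. This one-sided bound takes the
  -- place of additivity of the integral.
  ∫-extend : ∀ {S S′ B f M} c → BoundedOn S f M → BoundedOn S′ f M → FiniteOuterMeasure B →
    S ∩ (_< c) ⊆ S′ → S ∖ (_< c) ⊆ B → ∫ S f ≤ ∫ S′ f + M * μ B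
  ∫-extend {S} {S′} {B} {f} {M} c bdd bdd′ finB S<c⊆S′ S≥c⊆B = sup-least (∫-isSup bdd)
    λ (k , E , w , mE , E⊆S , disjoint , 0≤w , w≤f , v≡) → subst (_≤ _) (sym v≡)
      (simple-extend k E w mE E⊆S disjoint 0≤w w≤f)
    where
    open ≤-Reasoning
    simple-extend : ∀ k (E : Fin k → Pred ℝ 0ℓ) (w : Fin k → ℝ) → (∀ i → Measurable (E i)) → (∀ i → E i ⊆ S) →
      (∀ i j → i ≢ j → E i ⊥ E j) → (∀ i → 0# ≤ w i) → (∀ i {x} → x ∈ E i → w i ≤ f x) →
      sum (λ i → w i * μ (E i)) ≤ ∫ S′ f + M * μ B
    simple-extend k E w mE E⊆S disjoint 0≤w w≤f = begin
      sum (λ i → w i * μ (E i))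
        ≤⟨ sum-mono-≤ {k} (λ i → termwise i) ⟩
      sum (λ i → w i * μ (E i ∩ (_< c)) + w i * μ (B ∩ E i))
        ≡⟨ sum-+ (λ i → w i * μ (E i ∩ (_< c))) (λ i → w i * μ (B ∩ E i)) ⟩
      sum (λ i → w i * μ (E i ∩ (_< c))) + sum (λ i → w i * μ (B ∩ E i))
        ≤⟨ +-mono-≤ before after ⟩
      ∫ S′ f + M * μ B ∎
      where
      finE : ∀ i → FiniteOuterMeasure (E i)
      finE i = finite-⊆ (E⊆S i) (finiteMeasure bdd)
      termwise : ∀ i → w i * μ (E i) ≤ w i * μ (E i ∩ (_< c)) + w i * μ (B ∩ E i)
      termwise i = begin
        w i * μ (E i)
          ≡⟨ cong (w i *_) (<-measurable c (E i) (finE i)) ⟩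
        w i * (μ (E i ∩ (_< c)) + μ (E i ∖ (_< c)))
          ≤⟨ *-monoˡ-≤ (0≤w i) (+-monoʳ-≤ _ (μ-mono (finite-⊆ proj₁ finB)
               λ (x∈E , x≮c) → S≥c⊆B (E⊆S i x∈E , x≮c) , x∈E)) ⟩
        w i * (μ (E i ∩ (_< c)) + μ (B ∩ E i))
          ≡⟨ solve 3 (λ w a b → w :* (a :+ b) := w :* a :+ w :* b) refl (w i) _ _ ⟩
        w i * μ (E i ∩ (_< c)) + w i * μ (B ∩ E i) ∎
      before : sum (λ i → w i * μ (E i ∩ (_< c))) ≤ ∫ S′ f
      before = sup-ub (∫-isSup bdd′)
        ( k , (λ i → E i ∩ (_< c)) , w
        , (λ i → ∩-measurable (mE i) (<-measurable c))
        , (λ i (x∈E , x<c) → S<c⊆S′ (E⊆S i x∈E , x<c))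
        , (λ i j i≢j ((x∈Eᵢ , _) , (x∈Eⱼ , _)) → disjoint i j i≢j (x∈Eᵢ , x∈Eⱼ))
        , 0≤w , (λ i (x∈E , _) → w≤f i x∈E) , refl )
      after : sum (λ i → w i * μ (B ∩ E i)) ≤ M * μ B
      after = weightedSum-≤ finB (0≤M bdd) mE disjoint
        λ i _ x∈E → ≤-trans (w≤f i x∈E) (f≤M bdd (E⊆S i x∈E))

  -- For t ∈ A near sup A, the part of A in [t , sup A] has small measure.
  μ-≤-by-initial-parts : ∀ {A u b} → FiniteOuterMeasure A → UpperBound A u → 0# ≤ b →
    (∀ {t} → t ∈ A → μ (A ∩ (_< t)) ≤ b) → μ A ≤ b
  μ-≤-by-initial-parts {A} {u} {b} finA A≤u 0≤b initial = ≮⇒≥ λ b<μA →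
    -- The supremum of `A` is meaningful only once a point of `A` is given. Hence `b < μ A` is first
    -- used to refute every such point; then `A` is empty and has measure `0#`, a contradiction.
    <⇒≱ b<μA (≤-trans (inj₂ (μ-empty λ x∈A → impossible b<μA x∈A)) 0≤b)
    where
    near-sup : ∀ {m s t} → s - (m - b) < t → b + (s - t) < m
    near-sup {m} {s} {t} lt = <-from₁ lt
      (solve 4 (λ m b s t → m :- (b :+ (s :- t)) := t :- (s :- (m :- b))) refl m b s t)
    below-sup : ∀ {m} s → b < m → s - (m - b) < s
    below-sup {m} s b<m = <-from₁ b<m (solve 3 (λ s m b → s :- (s :- (m :- b)) := m :- b) refl s m b)
    impossible : b < μ A → ∀ {x} → x ∉ A
    impossible b<μA {x} x∈A = atPoint (proj₂ isSup _ (below-sup s b<μA))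
      where
      s = ⨆ A
      isSup : IsSup A s
      isSup = ⨆-isSup A (x , x∈A) (u , A≤u)
      split : ∀ t {y} → y ∈ A → y ∈ (A ∩ (_< t)) ∪ Icc t s
      split t {y} y∈A with <-or-≥ y t
      ... | inj₁ y<t = inj₁ (y∈A , y<t)
      ... | inj₂ t≤y = inj₂ (t≤y , sup-ub isSup y∈A)
      atPoint : ¬ (∃[ t ] (t ∈ A × s - (μ A - b) < t))
      atPoint (t , t∈A , s-δ<t) = <⇒≱ (near-sup s-δ<t)
        (≤-trans (μ-subadditive (finite-⊆ proj₁ finA) Icc-finite (split t))
          (+-mono-≤ (initial t∈A) (μ-Icc-≤ (sup-ub isSup t∈A))))

-- Work as a function of time, and existence of completion times

module Schedules (𝓡 : CompleteOrderedField) where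
  open Scheduling 𝓡
  open OrderedField 𝓡
  open OuterMeasure 𝓡
  open Integral 𝓡

  module _ {n : ℕ} (J : Jobs n) {σ : Assignment J} (isSchedule : IsSchedule J σ) where
    open IsSchedule isSchedule

    runTimes-disjoint : ∀ i j → i ≢ j → runTimes J σ i ⊥ runTimes J σ j
    runTimes-disjoint i j i≢j (run-i , run-j) = i≢j (just-injective (trans (sym run-i) run-j))

    runBefore-⊆Icc : ∀ j t → runTimes J σ j ∩ (_< t) ⊆ Icc (r (J j)) t
    runBefore-⊆Icc j t (run , x<t) = afterRelease j run , inj₁ x<t

    runBefore-finite : ∀ j t → FiniteOuterMeasure (runTimes J σ j ∩ (_< t))
    runBefore-finite j t = finite-⊆ (runBefore-⊆Icc j t) Icc-finite

    -- The bound is the speed at a possibly later time `u`: before the release the speed formula is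
    -- negative and cannot serve as a bound `M`. A common choice for `u` is `t ⊔ r (J j)`.
    speed-bounded : ∀ j {t u} → t ≤ u → r (J j) ≤ u → BoundedOn (runTimes J σ j ∩ (_< t)) (speed (J j)) (speed (J j) u)
    speed-bounded j {t} {u} t≤u r≤u = record
      { finiteMeasure = runBefore-finite j t
      ; 0≤M = subst (_≤ speed (J j) u) (zeroʳ (m (J j))) (*-monoˡ-≤ (inj₁ (0<m (J j))) (x≤y⇒0≤y-x r≤u))
      ; f≤M = λ (_ , x<t) → *-monoˡ-≤ (inj₁ (0<m (J j))) (+-monoˡ-≤ _ (≤-trans (inj₁ x<t) t≤u))
      }

    workBy-mono : ∀ j {s t} → s ≤ t → workBy J σ j s ≤ workBy J σ j t
    workBy-mono j {s} {t} s≤t = ∫-mono (speed-bounded j (x≤x⊔y t (r (J j))) (x≤y⊔x t (r (J j))))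
      λ (run , x<s) → run , <-≤-trans x<s s≤t

    workBy-release : ∀ j {t} → t ≤ r (J j) → workBy J σ j t ≤ 0#
    workBy-release j {t} t≤r = ≤-trans (∫-≤ (speed-bounded j t≤r ≤-refl))
      (inj₂ (trans (cong (speed (J j) (r (J j)) *_) (μ-empty λ (run , x<t) → <⇒≱ (<-≤-trans x<t t≤r) (afterRelease j run))) (zeroʳ _)))

    workBy-≥ : ∀ j {t c} → 0# ≤ c → (∀ {x} → x ∈ runTimes J σ j → c ≤ speed (J j) x) →
      c * μ (runTimes J σ j ∩ (_< t)) ≤ workBy J σ j t
    workBy-≥ j {t} 0≤c c≤ = ∫-≥ (speed-bounded j (x≤x⊔y t (r (J j))) (x≤y⊔x t (r (J j))))
      (∩-measurable (measurable j) (<-measurable t)) 0≤c λ (run , _) → c≤ run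

    -- Lipschitz continuity of the work: the running time from `s` on lies in `Icc s t`, at speed at
    -- most that at `u`. A fixed `u` makes the constant uniform in `t`.
    workBy-extend : ∀ j {s t u} → s ≤ t → t ≤ u → r (J j) ≤ u →
      workBy J σ j t ≤ workBy J σ j s + speed (J j) u * (t - s)
    workBy-extend j {s} {t} {u} s≤t t≤u r≤u = ≤-trans
      (∫-extend {B = Icc s t} s (speed-bounded j t≤u r≤u) (speed-bounded j (≤-trans s≤t t≤u) r≤u) Icc-finite
        (λ ((run , _) , x<s) → run , x<s) (λ ((_ , x<t) , x≮s) → ≮⇒≥ x≮s , inj₁ x<t))
      (+-monoʳ-≤ _ (*-monoˡ-≤ (BoundedOn.0≤M (speed-bounded j t≤u r≤u)) (μ-Icc-≤ s≤t)))

    -- The completion time is the infimum of the times at which the job is done; `workBy-extend`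
    -- shows that it is attained.
    completionTime : ∀ j {T} → CompletedBy J σ j T → ∃[ C ] (IsCompletionTime J σ j C × C ≤ T)
    completionTime j {T} done = C , (done-C , λ t t<C done-t → <⇒≱ t<C (⨅-lb inhabited release-lb done-t)) , ⨅-lb inhabited release-lb done
      where
      Done : Pred ℝ 0ℓ
      Done = CompletedBy J σ j
      inhabited : Satisfiable Done
      inhabited = T , done
      release-lb : ∀ {t} → t ∈ Done → r (J j) ≤ t
      release-lb done-t = ≮⇒≥ λ t<r → <⇒≱ (0<w (J j)) (≤-trans done-t (workBy-release j (inj₁ t<r)))
      C = ⨅ Done
      after : ∀ {t} → C < t → t ∈ Done
      after C<t = let (x , done-x , x<t) = ⨅-approx inhabited release-lb C<t in
        ≤-trans done-x (workBy-mono j (inj₁ x<t))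
      -- Any time after `C` would do: it fixes a positive speed bound `M` independent of `ε`.
      u = C + 1#
      C<u : C < u
      C<u = x<x+y C 0<1
      r<u : r (J j) < u
      r<u = ≤-<-trans (⨅-greatest inhabited release-lb release-lb) C<u
      M = speed (J j) u
      0<M : 0# < M
      0<M = *-pos (0<m (J j)) (x<y⇒0<y-x r<u)
      done-C : C ∈ Done
      done-C = ≤-by-ε λ ε 0<ε →
        -- At `t`, after `C`, the job is done, yet the work since `C` is at most `ε`. The cap at `u`
        -- keeps the bound `M` valid.
        let t = u ⊓ (C + ε / M)
            C<t = <-⊓-glb C<u (x<x+y C (/-pos 0<ε 0<M))
        in ≤-trans (after C<t) (≤-trans (workBy-extend j (inj₁ C<t) (x⊓y≤x u _) (inj₁ r<u))
          (+-monoʳ-≤ _ (subst (M * (t - C) ≤_) (*-cancel-/ ε 0<M) (*-monoˡ-≤ (inj₁ 0<M)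
            (z≤x+y⇒z-x≤y (x⊓y≤y u (C + ε / M)))))))

-- Comparison of Thrashing with a feasible schedule

module Thrashing (𝓡 : CompleteOrderedField) where
  open Scheduling 𝓡
  open OrderedField 𝓡
  open OuterMeasure 𝓡
  open Integral 𝓡
  open Schedules 𝓡

  span : Job → ℝ
  span j = d j - r j

  0<span : ∀ j → 0# < span j
  0<span j = x<y⇒0<y-x (r<d j)

  r+2l≤r+4l : ∀ r {l} → 0# < l → r + 2# * l ≤ r + 4# * l
  r+2l≤r+4l r {l} 0<l = ≤-from₂ (inj₁ 0<l) (inj₁ 0<l)
    (solve 2 (λ r l → (r :+ (:2 :+ :2) :* l) :- (r :+ :2 :* l) := (l :- :0) :+ (l :- :0)) refl r l)

  d≤r+4span : ∀ {r d} → r < d → d ≤ r + 4# * (d - r)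
  d≤r+4span {r} {d} r<d = ≤-from₂ (inj₁ r<d) (r+2l≤r+4l 0# (x<y⇒0<y-x r<d))
    (solve 2 (λ r d → (r :+ (:2 :+ :2) :* (d :- r)) :- d
                   := (d :- r) :+ ((:0 :+ (:2 :+ :2) :* (d :- r)) :- (:0 :+ :2 :* (d :- r)))) refl r d)

  d≤t-from-2span : ∀ {r d t} → r < d → 2# * (d - r) ≤ t - r → d ≤ t
  d≤t-from-2span {r} {d} {t} r<d 2span≤ = ≤-from₂ 2span≤ (inj₁ r<d)
    (solve 3 (λ r d t → t :- d := ((t :- r) :- :2 :* (d :- r)) :+ (d :- r)) refl r d t)

  4l-as-2·2l : ∀ r l → (r + 4# * l) - r ≡ 2# * ((r + 4# * l) - (r + 2# * l))
  4l-as-2·2l = solve 2 (λ r l → (r :+ (:2 :+ :2) :* l) :- r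
                     := :2 :* ((r :+ (:2 :+ :2) :* l) :- (r :+ :2 :* l))) refl

  move-2 : ∀ m l x → (m * l) * (2# * x) ≡ (m * (2# * l)) * x
  move-2 = solve 3 (λ m l x → (m :* l) :* (:2 :* x) := (m :* (:2 :* l)) :* x) refl

  module _ {n : ℕ} (J : Jobs n) {τ : Assignment J} (τ-isSchedule : IsSchedule J τ)
    (τ-within : ∀ j {t} → t ∈ runTimes J τ j → r (J j) ≤ t × t ≤ d (J j))
    (τ-done : ∀ j → CompletedBy J τ j (d (J j)))
    {σ : Assignment J} (isThrashing : IsThrashing J σ) where
    open IsThrashing isThrashing

    eligible : ∀ {i t} → t ∈ runTimes J σ i → Eligible J σ t i
    eligible {i} {t} run = proj₁ (subst (ThrashingChoice J σ t) run (choice t))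

    latest : ∀ {i j t} → t ∈ runTimes J σ i → Eligible J σ t j → r (J j) ≤ r (J i)
    latest {i} {j} {t} run = proj₂ (subst (ThrashingChoice J σ t) run (choice t)) j

    busy : ∀ {j t} → Eligible J σ t j → ∃[ i ] t ∈ runTimes J σ i
    busy {j} {t} el = cases (σ t) refl
      where
      cases : ∀ x → σ t ≡ x → ∃[ i ] σ t ≡ just i
      cases nothing  eq = ⊥-elim (subst (ThrashingChoice J σ t) eq (choice t) j el)
      cases (just i) eq = i , eq

    two-spans : ∀ {i t} → t ∈ runTimes J σ i → 2# * span (J i) ≤ t - r (J i)
    two-spans {i} run = ≤/⇒*≤ (0<span (J i)) (proj₂ (proj₂ (eligible run)))

    -- σ runs a job at least twice as fast as τ ever does.
    half-the-time : ∀ {K i t} → FiniteOuterMeasure K → Icc (r (J i)) (d (J i)) ⊆ K → ¬ CompletedBy J σ i t →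
      2# * μ (runTimes J σ i ∩ (_< t)) < μ (K ∩ runTimes J τ i)
    half-the-time {K} {i} {t} finK ⊆K unfinished = *-cancelˡ-< 0<sp (begin-strict
      sp * (2# * μ (runTimes J σ i ∩ (_< t)))
        ≡⟨ move-2 (m (J i)) (span (J i)) _ ⟩
      (m (J i) * (2# * span (J i))) * μ (runTimes J σ i ∩ (_< t))
        ≤⟨ workBy-≥ J isSchedule i (inj₁ (*-pos (0<m (J i)) (*-pos 0<2 (0<span (J i)))))
             (λ run → *-monoˡ-≤ (inj₁ (0<m (J i))) (two-spans run)) ⟩
      workBy J σ i t
        -- The only strict step: up to `t`, `σ` has done less than the whole work of `i`, while `τ`
        -- does all of it by the due date.
        <⟨ ≰⇒> unfinished ⟩
      w (J i)
        ≤⟨ τ-done i ⟩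
      workBy J τ i (d (J i))
        ≤⟨ ∫-≤ (speed-bounded J τ-isSchedule i ≤-refl (inj₁ (r<d (J i)))) ⟩
      sp * μ (runTimes J τ i ∩ (_< d (J i)))
        ≤⟨ *-monoˡ-≤ (inj₁ 0<sp) (μ-mono (finite-⊆ proj₁ finK) λ (run , _) → ⊆K (τ-within i run) , run) ⟩
      sp * μ (K ∩ runTimes J τ i) ∎)
      where
      open ≤-Reasoning
      sp = speed (J i) (d (J i))
      0<sp : 0# < sp
      0<sp = *-pos (0<m (J i)) (0<span (J i))

    -- The overload argument for one unfinished job

    module _ (j : Fin n) where
      private
        ρ = r (J j)
        D = span (J j)
        S = ρ + 2# * D
        T = ρ + 4# * D

      ρ≤S : ρ ≤ S
      ρ≤S = inj₁ (x<x+y ρ (*-pos 0<2 (0<span (J j))))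

      S≤T : S ≤ T
      S≤T = r+2l≤r+4l ρ (0<span (J j))

      -- Half-open to match `workBy`, which counts only times strictly before its argument; the
      -- missing endpoint is null.
      Window : Pred ℝ 0ℓ
      Window t = S ≤ t × t < T

      Window-finite : FiniteOuterMeasure Window
      Window-finite = finite-⊆ (λ (S≤t , t<T) → S≤t , inj₁ t<T) (Icc-finite {S} {T})

      μ-Window : T - S ≤ μ Window
      μ-Window = ≤-trans (μ-Icc-≥ S≤T) (subst (μ (Icc S T) ≤_) (+-identityʳ _)
        (≤-trans (μ-subadditive Window-finite Icc-finite split) (+-monoʳ-≤ _ (μ-Icc-point T))))
        where
        split : Icc S T ⊆ Window ∪ Icc T T
        split (S≤x , inj₁ x<T)  = inj₁ (S≤x , x<T)
        split (S≤x , inj₂ refl) = inj₂ (≤-refl , ≤-refl)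

      K = Icc ρ T

      module _ (unfinished : ¬ CompletedBy J σ j T) where

        eligible-in-Window : ∀ {t} → t ∈ Window → Eligible J σ t j
        eligible-in-Window {t} (S≤t , t<T) =
            ≤-trans ρ≤S S≤t
          , (λ done → unfinished (≤-trans done (workBy-mono J isSchedule j (inj₁ t<T))))
          , *≤⇒≤/ (0<span (J j)) (x+y≤z⇒y≤z-x S≤t)

        -- The left end uses the latest-release rule against the eligible job `j`; the right end
        -- uses that a job of stretch at least `2#` is past its due date.
        lifetime-⊆K : ∀ {i t} → t ∈ Window → t ∈ runTimes J σ i → Icc (r (J i)) (d (J i)) ⊆ K
        lifetime-⊆K {i} {t} t∈W run {x} (rᵢ≤x , x≤dᵢ) =
            ≤-trans (latest run (eligible-in-Window t∈W)) rᵢ≤x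
          , ≤-trans x≤dᵢ (≤-trans (d≤t-from-2span (r<d (J i)) (two-spans run)) (inj₁ (proj₂ t∈W)))

        -- Job `i` may finish inside the window, so `half-the-time` is applied at each time `t` of
        -- the window at which `i` runs and is therefore unfinished. This bounds the running time
        -- before each such `t`; `μ-≤-by-initial-parts` passes to the whole window and loses the
        -- strictness.
        window-time-≤ : ∀ i → 2# * μ (Window ∩ runTimes J σ i) ≤ μ (K ∩ runTimes J τ i)
        window-time-≤ i = subst (_≤ g) (*-comm (μ A) 2#) (≤/⇒*≤ {μ A} {g} 0<2 bound)
          where
          A = Window ∩ runTimes J σ i
          g = μ (K ∩ runTimes J τ i)
          -- This settles the jobs that never run in the window, whose lifetimes need not lie in
          -- `K`.
          0≤g : 0# ≤ g
          0≤g = μ≥0 (finite-⊆ proj₁ (Icc-finite {ρ} {T}))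
          initial : ∀ {t} → t ∈ A → μ (A ∩ (_< t)) ≤ g / 2#
          initial {t} (t∈W , run) = *≤⇒≤/ {μ (A ∩ (_< t))} {g} 0<2 (begin
            μ (A ∩ (_< t)) * 2#
              ≡⟨ *-comm (μ (A ∩ (_< t))) 2# ⟩
            2# * μ (A ∩ (_< t))
              ≤⟨ *-monoˡ-≤ (inj₁ 0<2) (μ-mono (runBefore-finite J isSchedule i t) λ ((_ , run′) , x<t) → run′ , x<t) ⟩
            2# * μ (runTimes J σ i ∩ (_< t))
              <⟨ half-the-time Icc-finite (lifetime-⊆K t∈W run) (proj₁ (proj₂ (eligible run))) ⟩
            g ∎)
            where open ≤-Reasoning
          bound : μ A ≤ g / 2#
          bound = μ-≤-by-initial-parts {A} {T} (finite-⊆ proj₁ Window-finite) (λ ((_ , t<T) , _) → inj₁ t<T)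
            (*≤⇒≤/ {0#} {g} 0<2 (subst (_≤ g) (sym (zeroˡ 2#)) 0≤g)) initial

        -- Job `j` is unfinished at `T` itself, so one application of `half-the-time` covers the
        -- whole window and stays strict.
        window-time-< : 2# * μ (Window ∩ runTimes J σ j) < μ (K ∩ runTimes J τ j)
        window-time-< = ≤-<-trans
          (*-monoˡ-≤ (inj₁ 0<2) (μ-mono (runBefore-finite J isSchedule j T) λ ((_ , t<T) , run) → run , t<T))
          (half-the-time Icc-finite (λ (r≤x , x≤d) → r≤x , ≤-trans x≤d (d≤r+4span (r<d (J j)))) unfinished)

        σ-time : T - S ≤ sum (λ i → μ (Window ∩ runTimes J σ i))
        σ-time = ≤-trans μ-Window (μ-subadditive-Fin {n} {Window} {λ i → Window ∩ runTimes J σ i}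
          Window-finite (λ i → finite-⊆ proj₁ Window-finite)
          λ t∈W → let (i , run) = busy (eligible-in-Window t∈W) in i , t∈W , run)

        -- `τ` runs one job at a time, so its run times are disjoint measurable sets competing for
        -- `K`.
        τ-time : sum (λ i → μ (K ∩ runTimes J τ i)) ≤ T - ρ
        τ-time = ≤-trans
          (Σμ≤μ {n} {K} {runTimes J τ} Icc-finite (IsSchedule.measurable τ-isSchedule) (runTimes-disjoint J τ-isSchedule))
          (μ-Icc-≤ (≤-trans ρ≤S S≤T))

        overloaded : T - ρ < T - ρ
        overloaded = begin-strict
          T - ρ
            ≡⟨ 4l-as-2·2l ρ D ⟩
          2# * (T - S)
            ≤⟨ *-monoˡ-≤ (inj₁ 0<2) σ-time ⟩
          2# * sum f
            ≡⟨ *-distribˡ-sum 2# f ⟩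
          sum (λ i → 2# * f i)
            <⟨ sum-mono-< {n} {λ i → 2# * f i} {g} window-time-≤ j window-time-< ⟩
          sum g
            ≤⟨ τ-time ⟩
          T - ρ ∎
          where
          open ≤-Reasoning
          f g : Fin n → ℝ
          f i = μ (Window ∩ runTimes J σ i)
          g i = μ (K ∩ runTimes J τ i)

      completedBy-4 : CompletedBy J σ j T
      -- Being completed is an inequality between reals, so trichotomy turns the refutation of the
      -- contrary into a proof.
      completedBy-4 = ≮⇒≥ λ work<w → <-irrefl refl (overloaded (<⇒≱ work<w))

      completed-within-4 : ∃[ C ] (IsCompletionTime J σ j C × stretch (J j) C ≤ 4#)
      completed-within-4 =
        let (C , isCompletionTime , C≤T) = completionTime J isSchedule j completedBy-4
        in C , isCompletionTime , ≤*⇒/≤ (0<span (J j))(z≤x+y⇒z-x≤y C≤T)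

mainTheorem7 : (𝓡 : CompleteOrderedField) → let open Scheduling 𝓡 in
    (n : ℕ) (J : Jobs n) → Feasible J →
    (σ : Assignment J) → IsThrashing J σ →
    (j : Fin n) → ∃[ C ] (IsCompletionTime J σ j C × stretch (J j) C ≤ 4#)
mainTheorem7 𝓡 n J (τ , τ-isSchedule , τ-within , τ-done) σ isThrashing =
  Thrashing.completed-within-4 𝓡 J τ-isSchedule τ-within τ-done isThrashing
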